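{- (1) For every special $\Pi^0_1$ set $P\subseteq2^{\mathbb N}$, we have $\bigtriangledown P<^{<\omega}_1P$ and $P\equiv^1_\omega\bigtriangledown P$. (2) For every special $\Pi^0_1$ set $P\subseteq2^{\mathbb N}$ there exists a $\Pi^0_1$ set $Q\subseteq2^{\mathbb N}$ with $Q<^{<\omega}_1P$ and $P\equiv^1_\omega Q$.
   Context: A set is special if it is nonempty and contains no computable element. With each $\Pi^0_1$ set $P\subseteq2^{\mathbb N}$ (given by an index) a corresponding computable tree $T_P\subseteq2^{<\mathbb N}$ whose set of infinite paths is $P$ is fixed; $L_P$ is the set of leaves (dead ends) of $T_P$. The concatenation is $P^\frown Q=P\cup\bigcup_{\rho\in L_P}\rho^\frown Q$ where $\rho^\frown Q=\{\rho^\frown f:f\in Q\}$, and $\bigtriangledown P=\bigcup_{n\in\mathbb N}(P^\frown\cdots{}^\frown P)$, where the $n$-th term is the iterated concatenation of $n+1$ copies of $P$; equivalently, $\bigtriangledown P=\{\rho_1{}^\frown\cdots{}^\frown\rho_k{}^\frown f:k\ge0,\ \rho_1,\dots,\rho_k\in L_P,\ f\in P\}$. Let $\{\Phi_e\}_{e\in\mathbb N}$ be an effective enumeration of all partial computable functions $\Phi_e:\subseteq\mathbb N^{\mathbb N}\to\mathbb N^{\mathbb N}$. A learner is a total computable function $\Psi:\mathbb N^{<\mathbb N}\to\mathbb N$. A partial function $\Gamma:\subseteq\mathbb N^{\mathbb N}\to\mathbb N^{\mathbb N}$ is $(<\omega,1)$-computable if there is $b\in\mathbb N$ such that for every $g\in\mathrm{dom}(\Gamma)$,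 $\Gamma(g)=\Phi_e(g)$ for some $e<b$. It is $(1,\omega)$-computable if there is a learner $\Psi$ such that for every $g\in\mathrm{dom}(\Gamma)$ the limit $\lim_n\Psi(g\upharpoonright n)$ exists and $\Phi_{\lim_n\Psi(g\upharpoonright n)}(g)=\Gamma(g)$. For $A,B\subseteq\mathbb N^{\mathbb N}$, $A\le^\alpha_\beta B$ means there is an $(\alpha,\beta)$-computable $\Gamma$ with $B\subseteq\mathrm{dom}(\Gamma)$ and $\Gamma(g)\in A$ for every $g\in B$. $A<^\alpha_\beta B$ means $A\le^\alpha_\beta B$ and $B\not\le^\alpha_\beta A$; $A\equiv^\alpha_\beta B$ means both reductions hold. -}

module Defs where

open import Data.Bool using (Bool; true; false; if_then_else_)
open import Data.List using (List; []; _∷_; _∷ʳ_; applyUpTo)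
open import Data.List.Relation.Unary.All using (All)
open import Data.Nat using (ℕ; zero; suc; _+_; _≤_; _<_; _≥_; z≤n; s≤s)
open import Data.Nat.Properties
  using (+-identityʳ; +-suc; +-comm; suc-injective; m≤m+n; m≤n+m; n≤1+n;
         ≤-refl; ≤-trans; ≤-pred; <-≤-trans; ≤-<-trans)
open import Data.Product using (_×_; _,_; ∃; proj₁; proj₂)
open import Level using (0ℓ)
open import Relation.Binary using (Rel; _Respects₂_)
open import Relation.Binary.PropositionalEquality
  using (_≡_; _≗_; refl; sym; trans; cong; cong₂; subst)
open import Relation.Nullary using (¬_)
open import Relation.Unary using (Pred; _∈_; _⊆_; _≐_; _∪_; ⋃; Satisfiable)

triangle : ℕ → ℕ
triangle zero    = zero
triangle (suc n) = suc n + triangle n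

pair : ℕ → ℕ → ℕ
pair x y = triangle (x + y) + x

-- The inverse of pair walks along the antidiagonals.
next : ℕ × ℕ → ℕ × ℕ
next (x , zero)  = zero , suc x
next (x , suc y) = suc x , y

unpair : ℕ → ℕ × ℕ
unpair zero    = zero , zero
unpair (suc n) = next (unpair n)

left right : ℕ → ℕ
left  n = proj₁ (unpair n)
right n = proj₂ (unpair n)

-- Unary oracle programs; several arguments are passed through pairing.
data Code : Set where
  zeroᶜ succᶜ leftᶜ rightᶜ oracleᶜ : Code
  pairᶜ compᶜ precᶜ               : Code → Code → Code
  muᶜ                             : Code → Code

PrimRec : (C D : ℕ → ℕ → Set) → ℕ → ℕ → ℕ → Set
PrimRec C D a zero    m = C a m
PrimRec C D a (suc k) m =
  ∃ λ r → PrimRec C D a k r × D (pair a (pair k r)) m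

-- ⟦ c ⟧ g n m : with oracle g, the program c halts on input n with output m.
⟦_⟧ : Code → (ℕ → ℕ) → ℕ → ℕ → Set
⟦ zeroᶜ     ⟧ g n m = m ≡ zero
⟦ succᶜ     ⟧ g n m = m ≡ suc n
⟦ leftᶜ     ⟧ g n m = m ≡ left n
⟦ rightᶜ    ⟧ g n m = m ≡ right n
⟦ oracleᶜ   ⟧ g n m = m ≡ g n
⟦ pairᶜ c d ⟧ g n m =
  ∃ λ x → ∃ λ y → ⟦ c ⟧ g n x × ⟦ d ⟧ g n y × m ≡ pair x y
⟦ compᶜ c d ⟧ g n m = ∃ λ x → ⟦ d ⟧ g n x × ⟦ c ⟧ g x m
⟦ precᶜ c d ⟧ g n m = PrimRec (⟦ c ⟧ g) (⟦ d ⟧ g) (left n) (right n) m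
⟦ muᶜ c     ⟧ g n m =
  ⟦ c ⟧ g (pair n m) zero ×
  (∀ k → k < m → ∃ λ v → ⟦ c ⟧ g (pair n k) (suc v))

encode : Code → ℕ
encode zeroᶜ       = pair 0 0
encode succᶜ       = pair 1 0
encode leftᶜ       = pair 2 0
encode rightᶜ      = pair 3 0
encode oracleᶜ     = pair 4 0
encode (pairᶜ c d) = pair 5 (pair (encode c) (encode d))
encode (compᶜ c d) = pair 6 (pair (encode c) (encode d))
encode (precᶜ c d) = pair 7 (pair (encode c) (encode d))
encode (muᶜ c)     = pair 8 (encode c)

-- The first argument is fuel; since the components of an index are smaller
-- than the index, fuel suc e is enough for the index e.
decodeWith : ℕ → ℕ → Code
decodeWith zero    e = zeroᶜ
decodeWith (suc k) e with unpair e
... | 0 , _ = zeroᶜ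
... | 1 , _ = succᶜ
... | 2 , _ = leftᶜ
... | 3 , _ = rightᶜ
... | 4 , _ = oracleᶜ
... | 5 , m = pairᶜ (decodeWith k (left m)) (decodeWith k (right m))
... | 6 , m = compᶜ (decodeWith k (left m)) (decodeWith k (right m))
... | 7 , m = precᶜ (decodeWith k (left m)) (decodeWith k (right m))
... | suc (suc (suc (suc (suc (suc (suc (suc _))))))) , m =
  muᶜ (decodeWith k m)

decode : ℕ → Code
decode e = decodeWith (suc e) e

pair-next : ∀ p → pair (proj₁ (next p)) (proj₂ (next p)) ≡
                  suc (pair (proj₁ p) (proj₂ p))
pair-next (x , zero) rewrite +-identityʳ x
  | +-identityʳ (x + triangle x) = cong suc (+-comm x (triangle x))
pair-next (x , suc y) rewrite +-suc x y =
  +-suc (triangle (suc (x + y))) x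

pair-unpair : ∀ n → pair (left n) (right n) ≡ n
pair-unpair zero    = refl
pair-unpair (suc n) =
  trans (pair-next (unpair n)) (cong suc (pair-unpair n))

unpair-pair : ∀ x y → unpair (pair x y) ≡ (x , y)
unpair-pair x y = go (x + y) x y refl
  where
  go : ∀ s x y → x + y ≡ s → unpair (pair x y) ≡ (x , y)
  go s zero zero eq = refl
  go (suc s) zero (suc y) eq =
    trans (cong unpair (pair-next (y , zero)))
          (cong next (go s y zero (trans (+-identityʳ y) (suc-injective eq))))
  go s (suc x) y eq =
    trans (cong unpair (pair-next (x , suc y)))
          (cong next (go s x (suc y) (trans (+-suc x y) eq)))

n≤triangle : ∀ n → n ≤ triangle n
n≤triangle zero    = z≤n
n≤triangle (suc n) = m≤m+n (suc n) (triangle n)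

x≤pair : ∀ x y → x ≤ pair x y
x≤pair x y = m≤n+m x (triangle (x + y))

y≤pair : ∀ x y → y ≤ pair x y
y≤pair x y = ≤-trans (m≤n+m y x)
  (≤-trans (n≤triangle (x + y)) (m≤m+n (triangle (x + y)) x))

y<pair : ∀ x y → y < pair (suc x) y
y<pair x y = subst (y <_) (sym (pair-next (x , suc y)))
  (s≤s (≤-trans (n≤1+n y) (y≤pair x (suc y))))

decodeWith-encode : ∀ k c → encode c < k → decodeWith k (encode c) ≡ c
decodeWith-encode₂ : ∀ k t c d → pair (suc t) (pair (encode c) (encode d)) < suc k →
  decodeWith k (left  (pair (encode c) (encode d))) ≡ c ×
  decodeWith k (right (pair (encode c) (encode d))) ≡ d

decodeWith-encode (suc k) zeroᶜ   _ = refl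
decodeWith-encode (suc k) succᶜ   _ = refl
decodeWith-encode (suc k) leftᶜ   _ = refl
decodeWith-encode (suc k) rightᶜ  _ = refl
decodeWith-encode (suc k) oracleᶜ _ = refl
decodeWith-encode (suc k) (pairᶜ c d) lt
  rewrite unpair-pair 5 (pair (encode c) (encode d)) =
  let p , q = decodeWith-encode₂ k 4 c d lt in cong₂ pairᶜ p q
decodeWith-encode (suc k) (compᶜ c d) lt
  rewrite unpair-pair 6 (pair (encode c) (encode d)) =
  let p , q = decodeWith-encode₂ k 5 c d lt in cong₂ compᶜ p q
decodeWith-encode (suc k) (precᶜ c d) lt
  rewrite unpair-pair 7 (pair (encode c) (encode d)) =
  let p , q = decodeWith-encode₂ k 6 c d lt in cong₂ precᶜ p q
decodeWith-encode (suc k) (muᶜ c) lt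
  rewrite unpair-pair 8 (encode c) =
  cong muᶜ (decodeWith-encode k c (<-≤-trans (y<pair 7 (encode c)) (≤-pred lt)))

decodeWith-encode₂ k t c d lt
  rewrite unpair-pair (encode c) (encode d) =
  decodeWith-encode k c (≤-<-trans (x≤pair (encode c) (encode d)) bound) ,
  decodeWith-encode k d (≤-<-trans (y≤pair (encode c) (encode d)) bound)
  where
  bound : pair (encode c) (encode d) < k
  bound = <-≤-trans (y<pair t (pair (encode c) (encode d))) (≤-pred lt)

decode-encode : ∀ c → decode (encode c) ≡ c
decode-encode c = decodeWith-encode (suc (encode c)) c ≤-refl

Baire : Set
Baire = ℕ → ℕ

_↾_ : Baire → ℕ → List ℕ
g ↾ n = applyUpTo g n

infixr 5 _⌢_

_⌢_ : List ℕ → Baire → Baire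
([]      ⌢ f) n       = f n
((x ∷ ρ) ⌢ f) zero    = x
((x ∷ ρ) ⌢ f) (suc n) = (ρ ⌢ f) n

-- Φ e g h : the e-th functional is defined at g with value h.
Φ : ℕ → Rel Baire 0ℓ
Φ e g h = ∀ n → ⟦ decode e ⟧ g n (h n)

-- Without an oracle means with a trivial (constantly zero) oracle.
Computable : Pred Baire 0ℓ
Computable f = ∃ λ c → ∀ n → ⟦ c ⟧ (λ _ → zero) n (f n)

⌜_⌝ : List ℕ → ℕ
⌜ []    ⌝ = zero
⌜ x ∷ σ ⌝ = suc (pair x ⌜ σ ⌝)

ComputableOnStrings : Pred (List ℕ → ℕ) 0ℓ
ComputableOnStrings F = ∃ λ c → ∀ σ → ⟦ c ⟧ (λ _ → zero) ⌜ σ ⌝ (F σ)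

-- Points of Baire space are compared pointwise.
record PartialFunction : Set₁ where
  field
    graph      : Rel Baire 0ℓ
    respects   : graph Respects₂ _≗_
    functional : ∀ {g h h′} → graph g h → graph g h′ → h ≗ h′

  dom : Pred Baire 0ℓ
  dom g = ∃ λ h → graph g h

open PartialFunction public

⟨<ω,1⟩-computable : Pred PartialFunction 0ℓ
⟨<ω,1⟩-computable Γ =
  ∃ λ b → ∀ {g h} → graph Γ g h → ∃ λ e → e < b × Φ e g h

HasLimit : (ℕ → ℕ) → ℕ → Set
HasLimit s e = ∃ λ N → ∀ n → n ≥ N → s n ≡ e

⟨1,ω⟩-computable : Pred PartialFunction 0ℓ
⟨1,ω⟩-computable Γ =
  ∃ λ (Ψ : List ℕ → ℕ) → ComputableOnStrings Ψ ×
    (∀ {g h} → graph Γ g h → ∃ λ e → HasLimit (λ n → Ψ (g ↾ n)) e × Φ e g h)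

infix 4 _≤[_]_ _<[_]_ _≡[_]_

_≤[_]_ : Pred Baire 0ℓ → Pred PartialFunction 0ℓ → Pred Baire 0ℓ → Set₁
A ≤[ 𝒞 ] B = ∃ λ Γ → 𝒞 Γ × B ⊆ dom Γ ×
  (∀ {g h} → g ∈ B → graph Γ g h → h ∈ A)

_<[_]_ : Pred Baire 0ℓ → Pred PartialFunction 0ℓ → Pred Baire 0ℓ → Set₁
A <[ 𝒞 ] B = A ≤[ 𝒞 ] B × ¬ (B ≤[ 𝒞 ] A)

_≡[_]_ : Pred Baire 0ℓ → Pred PartialFunction 0ℓ → Pred Baire 0ℓ → Set₁
A ≡[ 𝒞 ] B = A ≤[ 𝒞 ] B × B ≤[ 𝒞 ] A

-- Cantor space is the subspace of Baire space of {0,1}-valued functions.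
record ComputableTree : Set where
  field
    member     : List ℕ → Bool
    computable : ComputableOnStrings (λ σ → if member σ then 1 else 0)
    binary     : ∀ {σ} → member σ ≡ true → All (_< 2) σ
    closed     : ∀ {σ} x → member (σ ∷ʳ x) ≡ true → member σ ≡ true

Node : ComputableTree → Pred (List ℕ) 0ℓ
Node T σ = ComputableTree.member T σ ≡ true

Leaf : ComputableTree → Pred (List ℕ) 0ℓ
Leaf T σ = σ ∈ Node T × (∀ x → ¬ (σ ∷ʳ x) ∈ Node T)

Paths : ComputableTree → Pred Baire 0ℓ
Paths T f = ∀ n → (f ↾ n) ∈ Node T

IsΠ⁰₁ : Pred Baire 0ℓ → Set
IsΠ⁰₁ P = ∃ λ T → P ≐ Paths T

Special : Pred Baire 0ℓ → Set
Special P = Satisfiable P × (∀ {f} → f ∈ P → ¬ Computable f)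

-- T is the tree chosen for P; the concatenation depends on its leaves.
_⌢⟨_⟩_ : Pred Baire 0ℓ → ComputableTree → Pred Baire 0ℓ → Pred Baire 0ℓ
P ⌢⟨ T ⟩ Q =
  P ∪ λ g → ∃ λ ρ → ρ ∈ Leaf T × (∃ λ f → f ∈ Q × g ≗ ρ ⌢ f)

-- Nesting to the right: only the leaves of T, the tree for P, are needed.
iterate⌢ : ComputableTree → Pred Baire 0ℓ → ℕ → Pred Baire 0ℓ
iterate⌢ T P zero    = P
iterate⌢ T P (suc n) = P ⌢⟨ T ⟩ iterate⌢ T P n

▽ : ComputableTree → Pred Baire 0ℓ → Pred Baire 0ℓ
▽ T P = ⋃ ℕ (iterate⌢ T P)

{-# OPTIONS --safe #-}
module Submission where

-- A single Π⁰₁ set Q with P ⊆ Q ⊆ ▽P serves both parts. The learner that guesses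
-- the least j such that the input without its first j entries still looks like an
-- element of P shows that P is (1,ω)-reducible to ▽P, hence to Q.
--
-- For each leaf r of T, Q contains π ⌢ P for the strings π of a computable chain
-- r = π₀ ⊂ π₁ ⊂ …, where πₖ₊₁ is πₖ followed by a leaf of T and is chosen so that
-- one of the programs with index below the code of r produces, from the oracle
-- πₖ₊₁, the first ⌜πₖ⌝ values of a node of T. An infinite chain would provide a
-- computable path through T, so each chain is finite, which makes Q closed and
-- contained in ▽P. If some finite set of programs reduced P to Q, let r be a leaf
-- whose code exceeds their indices and π the last string of its chain. For f ∈ P
-- one of these programs maps π ⌢ f to an element of P, hence computes enough of
-- it from a finite part of π ⌢ f; extending this part to a leaf, one could
-- prolong the chain.

open import Defs
open import Axiom.ExcludedMiddle using (ExcludedMiddle)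
open import Data.Bool using (Bool; true; false; if_then_else_; _∧_; _∨_; not)
import Data.Bool as Bool
open import Data.Empty using (⊥)
open import Data.List
  using (List; []; _∷_; [_]; _++_; _∷ʳ_; length; drop; applyUpTo; initLast; _∷ʳ′_)
open import Data.List.Properties
  using (applyUpTo-∷ʳ; drop-all; ++-assoc; ++-identityʳ; ++-identityʳ-unique;
         length-applyUpTo; ∷ʳ-injectiveˡ)
open import Data.List.Relation.Unary.All using (All)
import Data.List.Relation.Unary.All as All
open import Data.List.Relation.Unary.All.Properties using (++⁺; ++⁻ʳ)
open import Data.Nat
  using (ℕ; zero; suc; _+_; _∸_; _⊔_; pred; _≤_; _<_; _<?_; _≟_; z≤n; s≤s)
open import Data.Nat.Properties
  using (≤-refl; ≤-reflexive; ≤-trans; ≤-antisym; ≤-total; ≤-pred; <-≤-trans; ≮⇒≥;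
         n≤1+n; m≤n⇒m≤1+n; m<n⇒m<1+n; m≤n⇒m<n∨m≡n; 0≢1+n;
         +-assoc; +-suc; +-identityʳ; +-mono-≤; +-monoʳ-≤; +-cancelˡ-≤; m≤m+n; m≤n+m; m<m+n;
         m≤m⊔n; m≤n⊔m; n∸n≡0; +-∸-assoc; pred[m∸n]≡m∸[1+n]; m∸n≡0⇒m≤n; m≤n⇒m∸n≡0;
         m+[n∸m]≡n; m∸n+n≡m)
open import Data.Product using (_×_; _,_; ∃; proj₁; proj₂)
open import Data.Sum using (_⊎_; inj₁; inj₂)
open import Function using (_∘_; id)
open import Level using (0ℓ)
open import Relation.Binary.PropositionalEquality
  using (_≡_; _≢_; _≗_; refl; sym; trans; cong; cong₂; subst; subst₂; module ≡-Reasoning)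
open import Relation.Nullary using (¬_; Dec; yes; no; does; contradiction)
open import Relation.Nullary.Decidable using (_×-dec_; _⊎-dec_; ¬?; dec-true; dec-false)
import Relation.Nullary.Decidable as Dec
open import Relation.Unary using (Pred; _≐_; _∈_; _⊆_)

-- Computable functions and predicates

left-pair : ∀ x y → left (pair x y) ≡ x
left-pair x y = cong proj₁ (unpair-pair x y)

right-pair : ∀ x y → right (pair x y) ≡ y
right-pair x y = cong proj₂ (unpair-pair x y)

-- A function of several arguments is computable if it is so as a function of
-- their iterated pair, which plays the role of an environment.
record Comp (f : ℕ → ℕ) : Set where
  constructor comp
  field
    code  : Code
    sound : ∀ n → ⟦ code ⟧ (λ _ → zero) n (f n)

open Comp

Comp-ext : ∀ {f g} → (∀ n → f n ≡ g n) → Comp f → Comp g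
Comp-ext eq (comp c s) = comp c (λ n → subst (⟦ c ⟧ _ n) (eq n) (s n))

zeroC : Comp (λ _ → zero)
zeroC = comp zeroᶜ (λ _ → refl)

sucC : Comp suc
sucC = comp succᶜ (λ _ → refl)

leftC : Comp left
leftC = comp leftᶜ (λ _ → refl)

rightC : Comp right
rightC = comp rightᶜ (λ _ → refl)

infixr 9 _∘C_

_∘C_ : ∀ {f g} → Comp f → Comp g → Comp (λ n → f (g n))
comp c s ∘C comp d t = comp (compᶜ c d) (λ n → _ , t n , s _)

pairC : ∀ {f g} → Comp f → Comp g → Comp (λ n → pair (f n) (g n))
pairC (comp c s) (comp d t) = comp (pairᶜ c d) (λ n → _ , _ , s n , t n , refl)

idC : Comp (λ n → n)
idC = Comp-ext pair-unpair (pairC leftC rightC)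

constC : ∀ k → Comp (λ _ → k)
constC zero    = zeroC
constC (suc k) = sucC ∘C constC k

app₂ : (f : ℕ → ℕ → ℕ) → ∀ {a b} → Comp (λ w → f (left w) (right w)) →
       Comp a → Comp b → Comp (λ n → f (a n) (b n))
app₂ f {a} {b} F A B =
  Comp-ext (λ n → cong₂ f (left-pair (a n) (b n)) (right-pair (a n) (b n)))
           (F ∘C pairC A B)

natrec : ℕ → (ℕ → ℕ → ℕ) → ℕ → ℕ
natrec z s zero    = z
natrec z s (suc k) = s k (natrec z s k)

natrecC : ∀ {z count} (step : ℕ → ℕ → ℕ → ℕ) → Comp z →
  Comp (λ w → step (left w) (left (right w)) (right (right w))) →
  Comp count → Comp (λ n → natrec (z n) (step n) (count n))
natrecC {z} step (comp c s) S =
  app₂ (λ n k → natrec (z n) (step n) k)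
       (comp (precᶜ c (code S)) (λ w → primrec (left w) (right w))) idC
  where
  primrec : ∀ n k → PrimRec (⟦ c ⟧ _) (⟦ code S ⟧ _) n k (natrec (z n) (step n) k)
  primrec n zero    = s n
  primrec n (suc k) = r , primrec n k ,
    subst (⟦ code S ⟧ _ _) step-pair (sound S (pair n (pair k r)))
    where
    r = natrec (z n) (step n) k

    step-pair : step (left (pair n (pair k r))) (left (right (pair n (pair k r))))
                     (right (right (pair n (pair k r)))) ≡ step n k r
    step-pair rewrite unpair-pair n (pair k r) | unpair-pair k r = refl

ifz : ℕ → ℕ → ℕ → ℕ
ifz zero    a b = a
ifz (suc _) a b = b

ifzC : ∀ {t a b} → Comp t → Comp a → Comp b → Comp (λ n → ifz (t n) (a n) (b n))
ifzC {t} {a} {b} T A B =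
  Comp-ext (λ n → eq n (t n)) (natrecC (λ n _ _ → b n) A (B ∘C leftC) T)
  where
  eq : ∀ n k → natrec (a n) (λ _ _ → b n) k ≡ ifz k (a n) (b n)
  eq n zero    = refl
  eq n (suc k) = refl

predC : ∀ {f} → Comp f → Comp (λ n → pred (f n))
predC {f} F =
  Comp-ext (λ n → eq (f n)) (natrecC (λ _ i _ → i) zeroC (leftC ∘C rightC) F)
  where
  eq : ∀ k → natrec 0 (λ i _ → i) k ≡ pred k
  eq zero    = refl
  eq (suc k) = refl

∸C : ∀ {f g} → Comp f → Comp g → Comp (λ n → f n ∸ g n)
∸C {f} {g} F G =
  Comp-ext (λ n → eq (f n) (g n))
           (natrecC (λ _ _ r → pred r) F (predC (rightC ∘C rightC)) G)
  where
  eq : ∀ a k → natrec a (λ _ r → pred r) k ≡ a ∸ k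
  eq a zero    = refl
  eq a (suc k) = trans (cong pred (eq a k)) (pred[m∸n]≡m∸[1+n] a k)

bit : Bool → ℕ
bit b = if b then 1 else 0

-- The characteristic function is read off the decision itself, so whatever is decided here can also
-- be used inside a program.
record RecPred (A : ℕ → Set) : Set where
  constructor recPred
  field
    dec  : ∀ n → Dec (A n)
    char : Comp (λ n → bit (does (dec n)))

open RecPred

infixr 9 _∘P_
infixr 7 _∧P_
infixr 6 _∨P_

_∘P_ : ∀ {A f} → RecPred A → Comp f → RecPred (λ n → A (f n))
recPred d c ∘P F = recPred (λ n → d _) (c ∘C F)

RecPred-⇔ : ∀ {A B : ℕ → Set} → (∀ n → A n → B n) → (∀ n → B n → A n) →
            RecPred A → RecPred B
RecPred-⇔ to from (recPred d c) = recPred (λ n → Dec.map′ (to n) (from n) (d n)) c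

_∧P_ : ∀ {A B} → RecPred A → RecPred B → RecPred (λ n → A n × B n)
recPred d c ∧P recPred d′ c′ = recPred (λ n → d n ×-dec d′ n)
  (Comp-ext (λ n → eq (does (d n)) (does (d′ n))) (ifzC c zeroC c′))
  where
  eq : ∀ a b → ifz (bit a) 0 (bit b) ≡ bit (a ∧ b)
  eq true  b = refl
  eq false b = refl

_∨P_ : ∀ {A B} → RecPred A → RecPred B → RecPred (λ n → A n ⊎ B n)
recPred d c ∨P recPred d′ c′ = recPred (λ n → d n ⊎-dec d′ n)
  (Comp-ext (λ n → eq (does (d n)) (does (d′ n))) (ifzC c c′ (constC 1)))
  where
  eq : ∀ a b → ifz (bit a) (bit b) 1 ≡ bit (a ∨ b)
  eq true  b = refl
  eq false b = refl

¬P : ∀ {A} → RecPred A → RecPred (λ n → ¬ A n)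
¬P (recPred d c) = recPred (λ n → ¬? (d n))
  (Comp-ext (λ n → eq (does (d n))) (ifzC c (constC 1) zeroC))
  where
  eq : ∀ a → ifz (bit a) 1 0 ≡ bit (not a)
  eq true  = refl
  eq false = refl

zeroP : ∀ {f} → Comp f → RecPred (λ n → f n ≡ 0)
zeroP {f} F = recPred (λ n → f n ≟ 0)
  (Comp-ext (λ n → eq (f n)) (ifzC F (constC 1) zeroC))
  where
  eq : ∀ k → ifz k 1 0 ≡ bit (does (k ≟ 0))
  eq zero    = refl
  eq (suc k) = refl

≤P : ∀ {f g} → Comp f → Comp g → RecPred (λ n → f n ≤ g n)
≤P F G = RecPred-⇔ (λ _ → m∸n≡0⇒m≤n) (λ _ → m≤n⇒m∸n≡0) (zeroP (∸C F G))

≡P : ∀ {f g} → Comp f → Comp g → RecPred (λ n → f n ≡ g n)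
≡P F G = RecPred-⇔ (λ n (p , q) → ≤-antisym p q)
                   (λ n p → ≤-reflexive p , ≤-reflexive (sym p))
                   (≤P F G ∧P ≤P G F)

-- By primitive recursion on the bound: the accumulator is zero exactly as long as no witness has
-- been met.
∃<P : ∀ {b} (A : ℕ → ℕ → Set) → RecPred (λ w → A (left w) (right w)) → Comp b →
      RecPred (λ n → ∃ λ i → i < b n × A n i)
∃<P {b} A R@(recPred d c) B = RecPred-⇔ to from
    (¬P (zeroP (natrecC step zeroC stepC B)))
  where
  step : ℕ → ℕ → ℕ → ℕ
  step n i r = ifz r (bit (does (d (pair n i)))) 1

  stepC : Comp (λ w → step (left w) (left (right w)) (right (right w)))
  stepC = ifzC (rightC ∘C rightC) (c ∘C pairC leftC (leftC ∘C rightC)) (constC 1)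

  unpaired : ∀ n i → A (left (pair n i)) (right (pair n i)) → A n i
  unpaired n i = subst₂ A (left-pair n i) (right-pair n i)

  search : ∀ n k → natrec 0 (step n) k ≢ 0 → ∃ λ i → i < k × A n i
  search n zero    ≢0 = contradiction refl ≢0
  search n (suc k) ≢0 with natrec 0 (step n) k in eq | d (pair n k)
  ... | suc _ | _     = let i , i<k , a = search n k (λ p → 0≢1+n (trans (sym p) eq))
                        in i , m<n⇒m<1+n i<k , a
  ... | zero  | yes a = k , ≤-refl , unpaired n k a
  ... | zero  | no  _ = contradiction refl ≢0

  found : ∀ n k {i} → i < k → A n i → natrec 0 (step n) k ≢ 0
  found n (suc k) {i} i<k a with natrec 0 (step n) k in eq | d (pair n k)
  ... | suc _ | _      = λ ()
  ... | zero  | yes _  = λ ()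
  ... | zero  | no  ¬a with m≤n⇒m<n∨m≡n (≤-pred i<k)
  ...   | inj₁ i<k′ = contradiction eq (found n k i<k′ a)
  ...   | inj₂ refl = contradiction
    (subst₂ A (sym (left-pair n i)) (sym (right-pair n i)) a) ¬a

  to : ∀ n → natrec 0 (step n) (b n) ≢ 0 → ∃ λ i → i < b n × A n i
  to n = search n (b n)

  from : ∀ n → (∃ λ i → i < b n × A n i) → natrec 0 (step n) (b n) ≢ 0
  from n (_ , i<b , a) = found n (b n) i<b a

∀<P : ∀ {b} (A : ℕ → ℕ → Set) → RecPred (λ w → A (left w) (right w)) → Comp b →
      RecPred (λ n → ∀ i → i < b n → A n i)
∀<P A R B = RecPred-⇔
  (λ n ¬∃ i i<b → Dec.decidable-stable (decA n i) (λ ¬a → ¬∃ (i , i<b , ¬a)))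
  (λ n all (i , i<b , ¬a) → ¬a (all i i<b))
  (¬P (∃<P (λ n i → ¬ A n i) (¬P R) B))
  where
  decA : ∀ n i → Dec (A n i)
  decA n i = subst₂ (λ x y → Dec (A x y)) (left-pair n i) (right-pair n i) (dec R (pair n i))

-- Codes of strings

-- The first argument is fuel. Since `right n ≤ n`, the code of a string is enough fuel for decoding
-- it.
listWith : ℕ → ℕ → List ℕ
listWith zero    n       = []
listWith (suc k) zero    = []
listWith (suc k) (suc n) = left n ∷ listWith k (right n)

list : ℕ → List ℕ
list n = listWith n n

right≤ : ∀ n → right n ≤ n
right≤ n = subst (right n ≤_) (pair-unpair n) (y≤pair (left n) (right n))

⌜list⌝ : ∀ n → ⌜ list n ⌝ ≡ n
⌜list⌝ n = go n n ≤-refl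
  where
  go : ∀ k n → n ≤ k → ⌜ listWith k n ⌝ ≡ n
  go zero    zero    _  = refl
  go (suc k) zero    _  = refl
  go (suc k) (suc n) le = cong suc
    (trans (cong (pair (left n)) (go k (right n) (≤-trans (right≤ n) (≤-pred le))))
           (pair-unpair n))

list-⌜⌝ : ∀ σ → list ⌜ σ ⌝ ≡ σ
list-⌜⌝ σ = go ⌜ σ ⌝ σ ≤-refl
  where
  go : ∀ k σ → ⌜ σ ⌝ ≤ k → listWith k ⌜ σ ⌝ ≡ σ
  go zero    []      _  = refl
  go (suc k) []      _  = refl
  go (suc k) (x ∷ σ) le = cong₂ _∷_ (left-pair x ⌜ σ ⌝)
    (trans (cong (listWith k) (right-pair x ⌜ σ ⌝))
           (go k σ (≤-trans (y≤pair x ⌜ σ ⌝) (≤-pred le))))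

length≤⌜⌝ : ∀ σ → length σ ≤ ⌜ σ ⌝
length≤⌜⌝ []      = z≤n
length≤⌜⌝ (x ∷ σ) = s≤s (≤-trans (length≤⌜⌝ σ) (y≤pair x ⌜ σ ⌝))

-- The head is removed by `right ∘ pred`, which fixes the code 0 of the empty string, just as `drop`
-- leaves the empty string unchanged.
tailN : ℕ → ℕ → ℕ
tailN q i = natrec q (λ _ r → right (pred r)) i

tailN-⌜⌝ : ∀ σ i → tailN ⌜ σ ⌝ i ≡ ⌜ drop i σ ⌝
tailN-⌜⌝ σ zero    = refl
tailN-⌜⌝ σ (suc i) = trans (cong (right ∘ pred) (tailN-⌜⌝ σ i)) (tail-drop i σ)
  where
  tail-drop : ∀ i σ → right (pred ⌜ drop i σ ⌝) ≡ ⌜ drop (suc i) σ ⌝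
  tail-drop zero    []      = refl
  tail-drop zero    (x ∷ σ) = right-pair x ⌜ σ ⌝
  tail-drop (suc i) []      = refl
  tail-drop (suc i) (x ∷ σ) = tail-drop i σ

tailC : ∀ {q i} → Comp q → Comp i → Comp (λ n → ⌜ drop (i n) (list (q n)) ⌝)
tailC {q} {i} Q I = Comp-ext
  (λ n → trans (cong (λ x → tailN x (i n)) (sym (⌜list⌝ (q n))))
               (tailN-⌜⌝ (list (q n)) (i n)))
  (natrecC (λ _ _ r → right (pred r)) Q (rightC ∘C predC (rightC ∘C rightC)) I)

module _ {A : Set} where

  recList : A → (ℕ → List ℕ → A → A) → List ℕ → A
  recList z s []      = z
  recList z s (x ∷ σ) = s x σ (recList z s σ)

  -- The outer `recList` on the right ignores its recursive value and only separates the empty from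
  -- the nonempty case. So this is one unfolding in which the recursive value belongs to the next
  -- final segment.
  recList-drop : ∀ z s i σ → recList z s (drop i σ) ≡
    recList z (λ x τ _ → s x τ (recList z s (drop (suc i) σ))) (drop i σ)
  recList-drop z s zero    []      = refl
  recList-drop z s zero    (x ∷ σ) = refl
  recList-drop z s (suc i) []      = refl
  recList-drop z s (suc i) (x ∷ σ) = recList-drop z s i σ

-- The recursion runs upwards through the final segments of the string.
recListC : ∀ {z q} (step : ℕ → ℕ → ℕ → ℕ → ℕ) → Comp z →
  Comp (λ w → step (left w) (left (right w)) (left (right (right w)))
                   (right (right (right w)))) →
  Comp q → Comp (λ n → recList (z n) (λ x τ → step n x ⌜ τ ⌝) (list (q n)))
recListC {z} {q} step Z S Q = Comp-ext result (natrecC body Z bodyC Q)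
  where
  tail : ℕ → ℕ → ℕ
  tail n i = ⌜ drop (q n ∸ suc i) (list (q n)) ⌝

  stepAt : ℕ → ℕ → ℕ → ℕ
  stepAt n t r = step n (left (pred t)) (right (pred t)) r

  body : ℕ → ℕ → ℕ → ℕ
  body n i r = ifz (tail n i) (z n) (stepAt n (tail n i) r)

  T : Comp (λ w → tail (left w) (left (right w)))
  T = tailC (Q ∘C leftC) (∸C (Q ∘C leftC) (sucC ∘C leftC ∘C rightC))

  bodyC : Comp (λ w → body (left w) (left (right w)) (right (right w)))
  bodyC = ifzC T (Z ∘C leftC)
    (Comp-ext (λ w → unpack w (left (pred (T′ w))) (right (pred (T′ w))) (right (right w)))
    (S ∘C pairC leftC (pairC (leftC ∘C predC T)
      (pairC (rightC ∘C predC T) (rightC ∘C rightC)))))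
    where
    T′ : ℕ → ℕ
    T′ w = tail (left w) (left (right w))

    unpack : ∀ w a b c → let u = pair (left w) (pair a (pair b c)) in
      step (left u) (left (right u)) (left (right (right u))) (right (right (right u))) ≡
      step (left w) a b c
    unpack w a b c rewrite unpair-pair (left w) (pair a (pair b c))
      | unpair-pair a (pair b c) | unpair-pair b c = refl

  F : ℕ → List ℕ → ℕ
  F n = recList (z n) (λ x τ → step n x ⌜ τ ⌝)

  body-list : ∀ n σ r → ifz ⌜ σ ⌝ (z n) (stepAt n ⌜ σ ⌝ r) ≡
                        recList (z n) (λ x τ _ → step n x ⌜ τ ⌝ r) σ
  body-list n []      r = refl
  body-list n (x ∷ σ) r = cong₂ (λ a b → step n a b r) (left-pair x ⌜ σ ⌝) (right-pair x ⌜ σ ⌝)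

  invariant : ∀ n i → i ≤ q n →
    natrec (z n) (body n) i ≡ F n (drop (q n ∸ i) (list (q n)))
  -- The code `q n` is at least the length of the string, so the recursion starts from the empty
  -- final segment.
  invariant n zero le = sym (cong (F n) (drop-all (q n) (list (q n))
    (≤-trans (length≤⌜⌝ (list (q n))) (≤-reflexive (⌜list⌝ (q n))))))
  invariant n (suc i) le = begin
    body n i (natrec (z n) (body n) i)
      ≡⟨ cong (body n i) (invariant n i (≤-trans (n≤1+n i) le)) ⟩
    body n i (F n (drop (q n ∸ i) σ))
      ≡⟨ cong (λ j → body n i (F n (drop j σ))) (+-∸-assoc 1 le) ⟩
    body n i (F n (drop (suc (q n ∸ suc i)) σ))
      ≡⟨ body-list n (drop (q n ∸ suc i) σ) _ ⟩
    recList (z n) (λ x τ _ → step n x ⌜ τ ⌝ (F n (drop (suc (q n ∸ suc i)) σ)))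
      (drop (q n ∸ suc i) σ)
      ≡⟨ recList-drop (z n) (λ x τ → step n x ⌜ τ ⌝) (q n ∸ suc i) σ ⟨
    F n (drop (q n ∸ suc i) σ) ∎
    where
    open ≡-Reasoning
    σ = list (q n)

  result : ∀ n → natrec (z n) (body n) (q n) ≡ F n (list (q n))
  result n = trans (invariant n (q n) ≤-refl)
                   (cong (λ j → F n (drop j (list (q n)))) (n∸n≡0 (q n)))

++C : ∀ {p q} → Comp p → Comp q → Comp (λ n → ⌜ list (p n) ++ list (q n) ⌝)
++C {p} {q} P Q = Comp-ext (λ n → eq n (list (p n)))
  (recListC (λ _ x _ r → suc (pair x r)) Q
    (sucC ∘C pairC (leftC ∘C rightC) (rightC ∘C rightC ∘C rightC)) P)
  where
  eq : ∀ n σ → recList (q n) (λ x _ r → suc (pair x r)) σ ≡ ⌜ σ ++ list (q n) ⌝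
  eq n []      = sym (⌜list⌝ (q n))
  eq n (x ∷ σ) = cong (suc ∘ pair x) (eq n σ)

∷ʳC : ∀ {q x} → Comp q → Comp x → Comp (λ n → ⌜ list (q n) ∷ʳ x n ⌝)
∷ʳC {q} {x} Q X = Comp-ext
  (λ n → cong (λ σ → ⌜ list (q n) ++ σ ⌝) (list-⌜⌝ [ x n ]))
  (++C Q (sucC ∘C pairC X zeroC))

applyUpToC : ∀ {k} (h : ℕ → ℕ → ℕ) → Comp (λ w → h (left w) (right w)) → Comp k →
             Comp (λ n → ⌜ applyUpTo (h n) (k n) ⌝)
applyUpToC {k} h H K = Comp-ext (λ n → eq n (k n))
  (natrecC (λ n i r → ⌜ list r ∷ʳ h n i ⌝) zeroC
    (∷ʳC (rightC ∘C rightC) (app₂ h H leftC (leftC ∘C rightC))) K)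
  where
  eq : ∀ n k → natrec 0 (λ i r → ⌜ list r ∷ʳ h n i ⌝) k ≡ ⌜ applyUpTo (h n) k ⌝
  eq n zero    = refl
  eq n (suc k) = trans
    (cong (λ σ → ⌜ σ ∷ʳ h n k ⌝) (trans (cong list (eq n k)) (list-⌜⌝ _)))
    (cong ⌜_⌝ (applyUpTo-∷ʳ (h n) k))

-- A small-step interpreter of programs

-- A state is a stack of frames together with either a value to be returned to
-- the top frame or an index to be evaluated at an argument.
returning : ℕ → ℕ → ℕ
returning K v = pair K (pair 0 v)

evaluating : ℕ → ℕ → ℕ → ℕ
evaluating K e n = pair K (pair (suc e) n)

push : ℕ → ℕ → ℕ
push f K = suc (pair f K)

-- The frames of pairᶜ c d (with c, then d, under evaluation), of compᶜ c d
-- (with d under evaluation), of precᶜ c d and of muᶜ c.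
firstFrame precFrame : ℕ → ℕ → ℕ
secondFrame compFrame : ℕ → ℕ
muFrame : ℕ → ℕ → ℕ → ℕ
firstFrame d n  = pair 0 (pair d n)
compFrame c     = pair 1 c
precFrame d ak  = pair 2 (pair d ak)
muFrame c n k   = pair 3 (pair c (pair n k))
secondFrame x   = pair 4 x

-- The index `e` has the components `t` and `b`; it is passed on as well because a waiting query and
-- a primitive recursion are evaluated again under the same index. After the earlier tests,
-- `ifz (t ∸ k)` tests whether `t` is `k`.
evalStep : (ℕ → ℕ) → ℕ → ℕ → ℕ → ℕ → ℕ → ℕ
evalStep O K t b e x =
  ifz t       (returning K 0)
 (ifz (t ∸ 1) (returning K (suc x))
 (ifz (t ∸ 2) (returning K (left x))
 (ifz (t ∸ 3) (returning K (right x))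
 (ifz (t ∸ 4) (ifz (O x) (evaluating K e x) (returning K (pred (O x))))
 (ifz (t ∸ 5) (evaluating (push (firstFrame (right b) x) K) (left b) x)
 (ifz (t ∸ 6) (evaluating (push (compFrame (left b)) K) (right b) x)
 (ifz (t ∸ 7)
    (ifz (right x) (evaluating K (left b) (left x))
      (evaluating (push (precFrame (right b) (pair (left x) (pred (right x)))) K) e
                  (pair (left x) (pred (right x)))))
    (evaluating (push (muFrame b x 0) K) b (pair x 0)))))))))

returnStep : ℕ → ℕ → ℕ → ℕ → ℕ
returnStep K t b v =
  ifz t       (evaluating (push (secondFrame v) K) (left b) (right b))
 (ifz (t ∸ 1) (evaluating K b v)
 (ifz (t ∸ 2) (evaluating K (left b)
                (pair (left (right b)) (pair (right (right b)) v)))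
 (ifz (t ∸ 3) (ifz v (returning K (right (right b)))
                (evaluating (push (muFrame (left b) (left (right b)) (suc (right (right b)))) K)
                   (left b) (pair (left (right b)) (suc (right (right b))))))
              (returning K (pair b v)))))

-- An oracle answers suc of its value, or zero for no answer; without an answer
-- the machine waits.
stepAt : (ℕ → ℕ) → ℕ → ℕ → ℕ → ℕ
stepAt O K m x =
  ifz m (ifz K (returning 0 x)
               (returnStep (right (pred K)) (left (left (pred K))) (right (left (pred K))) x))
        (evalStep O K (left (pred m)) (right (pred m)) (pred m) x)

step : (ℕ → ℕ) → ℕ → ℕ
step O st = stepAt O (left st) (left (right st)) (right (right st))

run : (ℕ → ℕ) → ℕ → ℕ → ℕ
run O zero    st = st
run O (suc t) st = run O t (step O st)

step-pair : ∀ O K m x → step O (pair K (pair m x)) ≡ stepAt O K m x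
step-pair O K m x rewrite unpair-pair K (pair m x) | unpair-pair m x = refl

step-evaluating : ∀ O K t b x → step O (evaluating K (pair t b) x) ≡ evalStep O K t b (pair t b) x
step-evaluating O K t b x = trans (step-pair O K (suc (pair t b)) x)
  (cong₂ (λ u v → evalStep O K u v (pair t b) x) (left-pair t b) (right-pair t b))

step-returning : ∀ O K t b x → step O (returning (push (pair t b) K) x) ≡ returnStep K t b x
step-returning O K t b x = trans (step-pair O (push (pair t b) K) 0 x) lemma
  where
  lemma : returnStep (right (pair (pair t b) K)) (left (left (pair (pair t b) K)))
                     (right (left (pair (pair t b) K))) x ≡ returnStep K t b x
  lemma rewrite unpair-pair (pair t b) K | unpair-pair t b = refl

run-+ : ∀ O s t st → run O (s + t) st ≡ run O t (run O s st)
run-+ O zero    t st = refl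
run-+ O (suc s) t st = run-+ O s t (step O st)

run-fixed : ∀ O t {st} → step O st ≡ st → run O t st ≡ st
run-fixed O zero    eq = refl
run-fixed O (suc t) eq = trans (cong (run O t) eq) (run-fixed O t eq)

-- A finite run sees only finitely much of `g`. It is the same for every partial oracle that answers
-- correctly below `use`, in particular for long enough initial segments of `g`.
record Reaches (g : Baire) (s s′ : ℕ) : Set where
  constructor reaches
  field
    use   : ℕ
    steps : ℕ
    run≡  : ∀ O → (∀ i → i < use → O i ≡ suc (g i)) → run O steps s ≡ s′

open Reaches

infixr 4 _⟫_

_⟫_ : ∀ {g s s′ s″} → Reaches g s s′ → Reaches g s′ s″ → Reaches g s s″
reaches B t p ⟫ reaches B′ t′ p′ = reaches (B ⊔ B′) (t + t′) λ O agree →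
  trans (run-+ O t t′ _)
    (trans (cong (run O t′) (p O (λ i i<B → agree i (<-≤-trans i<B (m≤m⊔n B B′)))))
           (p′ O (λ i i<B′ → agree i (<-≤-trans i<B′ (m≤n⊔m B B′)))))

oneStep : ∀ {g s s′} → (∀ O → step O s ≡ s′) → Reaches g s s′
oneStep eq = reaches 0 1 (λ O _ → eq O)

evaluate : ∀ {g s′} K t b x → (∀ O → evalStep O K t b (pair t b) x ≡ s′) →
           Reaches g (evaluating K (pair t b) x) s′
evaluate K t b x eq = oneStep (λ O → trans (step-evaluating O K t b x) (eq O))

return : ∀ {g s′} K t b x → returnStep K t b x ≡ s′ →
         Reaches g (returning (push (pair t b) K) x) s′
return K t b x eq = oneStep (λ O → trans (step-returning O K t b x) eq)

-- Induction on the program. The stack is arbitrary, so that the induction hypothesis applies to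
-- subprograms running under newly pushed frames.
machine-complete : ∀ c {g n m} K → ⟦ c ⟧ g n m →
  Reaches g (evaluating K (encode c) n) (returning K m)

primRec-complete : ∀ c d {g} a k {m} K → PrimRec (⟦ c ⟧ g) (⟦ d ⟧ g) a k m →
  Reaches g (evaluating K (encode (precᶜ c d)) (pair a k)) (returning K m)

-- Here `k` is the candidate under test and `j` the number of candidates that remain before the
-- value `m`; the induction is on `j`.
mu-complete : ∀ c {g n m} j k K → k + j ≡ m → ⟦ muᶜ c ⟧ g n m →
  Reaches g (evaluating (push (muFrame (encode c) n k) K) (encode c) (pair n k)) (returning K m)

machine-complete zeroᶜ   {n = n} K refl = evaluate K 0 0 n (λ _ → refl)
machine-complete succᶜ   {n = n} K refl = evaluate K 1 0 n (λ _ → refl)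
machine-complete leftᶜ   {n = n} K refl = evaluate K 2 0 n (λ _ → refl)
machine-complete rightᶜ  {n = n} K refl = evaluate K 3 0 n (λ _ → refl)
machine-complete oracleᶜ {g} {n} K refl = reaches (suc n) 1 λ O agree →
  trans (step-evaluating O K 4 0 n)
        (cong (λ u → ifz u (evaluating K (pair 4 0) n) (returning K (pred u))) (agree n ≤-refl))
machine-complete (pairᶜ c d) {g} {n} K (x , y , p , q , refl) =
  evaluate K 5 (pair C D) n (λ _ → cong₂ (λ u v → evaluating (push (firstFrame u n) K) v n)
                                         (right-pair C D) (left-pair C D)) ⟫
  machine-complete c (push (firstFrame D n) K) p ⟫
  return K 0 (pair D n) x
    (cong₂ (evaluating (push (secondFrame x) K)) (left-pair D n) (right-pair D n)) ⟫
  machine-complete d (push (secondFrame x) K) q ⟫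
  return K 4 x y refl
  where
  C = encode c
  D = encode d
machine-complete (compᶜ c d) {g} {n} K (x , p , q) =
  evaluate K 6 (pair C D) n (λ _ → cong₂ (λ u v → evaluating (push (compFrame u) K) v n)
                                         (left-pair C D) (right-pair C D)) ⟫
  machine-complete d (push (compFrame C) K) p ⟫
  return K 1 C x refl ⟫
  machine-complete c K q
  where
  C = encode c
  D = encode d
machine-complete (precᶜ c d) {g} {n} {m} K p =
  subst (λ u → Reaches g (evaluating K (encode (precᶜ c d)) u) (returning K m)) (pair-unpair n)
        (primRec-complete c d (left n) (right n) K p)
machine-complete (muᶜ c) {n = n} {m} K p =
  evaluate K 8 (encode c) n (λ _ → refl) ⟫ mu-complete c {n = n} m 0 K refl p

primRec-complete c d a zero K p =
  evaluate K 7 (pair C D) (pair a 0) (λ _ → unfold _) ⟫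
  machine-complete c K p
  where
  C = encode c
  D = encode d

  unfold : ∀ u → ifz (right (pair a 0)) (evaluating K (left (pair C D)) (left (pair a 0))) u ≡
                 evaluating K C a
  unfold u rewrite unpair-pair a 0 | unpair-pair C D = refl
primRec-complete c d a (suc k) K (r , p , q) =
  evaluate K 7 (pair C D) (pair a (suc k)) (λ _ → unfold) ⟫
  primRec-complete c d a k (push (precFrame D (pair a k)) K) p ⟫
  return K 2 (pair D (pair a k)) r pop ⟫
  machine-complete d K q
  where
  C = encode c
  D = encode d

  unfold : ifz (right (pair a (suc k))) (evaluating K (left (pair C D)) (left (pair a (suc k))))
      (evaluating (push (precFrame (right (pair C D))
                    (pair (left (pair a (suc k))) (pred (right (pair a (suc k)))))) K)
         (pair 7 (pair C D)) (pair (left (pair a (suc k))) (pred (right (pair a (suc k)))))) ≡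
    evaluating (push (precFrame D (pair a k)) K) (pair 7 (pair C D)) (pair a k)
  unfold rewrite unpair-pair a (suc k) | unpair-pair C D = refl

  pop : evaluating K (left (pair D (pair a k))) (pair (left (right (pair D (pair a k))))
          (pair (right (right (pair D (pair a k)))) r)) ≡
        evaluating K D (pair a (pair k r))
  pop rewrite unpair-pair D (pair a k) | unpair-pair a k = refl

muReturn : ∀ K C n k v → returnStep K 3 (pair C (pair n k)) v ≡
  ifz v (returning K k) (evaluating (push (muFrame C n (suc k)) K) C (pair n (suc k)))
muReturn K C n k v rewrite unpair-pair C (pair n k) | unpair-pair n k = refl

mu-complete c {n = n} zero k K refl (p , _) rewrite +-identityʳ k =
  machine-complete c (push (muFrame (encode c) n k) K) p ⟫
  return K 3 (pair (encode c) (pair n k)) 0 (muReturn K (encode c) n k 0)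
mu-complete c {n = n} (suc j) k K refl (p , below) =
  let v , q = below k (m<m+n k (s≤s z≤n)) in
  machine-complete c (push (muFrame (encode c) n k) K) q ⟫
  return K 3 (pair (encode c) (pair n k)) (suc v) (muReturn K (encode c) n k (suc v)) ⟫
  mu-complete c {n = n} j (suc k) K (sym (+-suc k j)) (p , below)

-- Strings as oracles

at : List ℕ → ℕ → ℕ
at []      i       = 0
at (x ∷ σ) zero    = suc x
at (x ∷ σ) (suc i) = at σ i

at-++ : ∀ σ τ i {v} → at σ i ≡ suc v → at (σ ++ τ) i ≡ suc v
at-++ (x ∷ σ) τ zero    eq = eq
at-++ (x ∷ σ) τ (suc i) eq = at-++ σ τ i eq

at-↾ : ∀ g k i → i < k → at (g ↾ k) i ≡ suc (g i)
at-↾ g (suc k) zero    _   = refl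
at-↾ g (suc k) (suc i) i<k = at-↾ (g ∘ suc) k i (≤-pred i<k)

result : ℕ → ℕ
result st = ifz (left st) (ifz (left (right st)) (suc (right (right st))) 0) 0

result-returning : ∀ m → result (returning 0 m) ≡ suc m
result-returning m rewrite unpair-pair 0 (pair 0 m) | unpair-pair 0 m = refl

result≡suc : ∀ st {m} → result st ≡ suc m → st ≡ returning 0 m
result≡suc st eq with left st in p | left (right st) in q | eq
... | zero | zero | refl = trans (sym (pair-unpair st))
  (cong₂ pair p (trans (sym (pair-unpair (right st))) (cong (λ u → pair u (right (right st))) q)))

-- The value of the program e at n, with oracle σ and ⌜ σ ⌝ steps, is m if this
-- is suc m, and it is undefined if this is zero.
eval : ℕ → List ℕ → ℕ → ℕ
eval e σ n = result (run (at σ) ⌜ σ ⌝ (evaluating 0 e n))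

step-final : ∀ O m → step O (returning 0 m) ≡ returning 0 m
step-final O m = step-pair O 0 0 m

-- Only the oracle instruction looks at the oracle. Either its query is answered, and then both
-- oracles give the same answer, or the machine with oracle `O` waits and its state does not change.
step-mono : ∀ {O O′} → (∀ i {v} → O i ≡ suc v → O′ i ≡ suc v) →
            ∀ st → step O′ st ≡ step O st ⊎ step O st ≡ st
step-mono {O} {O′} ext st = go (left st) (left (right st)) (right (right st))
  (trans (cong (pair (left st)) (pair-unpair (right st))) (pair-unpair st))
  where
  evalStep-mono : ∀ K t b e x → evalStep O′ K t b e x ≡ evalStep O K t b e x ⊎
                                evalStep O K t b e x ≡ evaluating K e x
  evalStep-mono K 0 b e x = inj₁ refl
  evalStep-mono K 1 b e x = inj₁ refl
  evalStep-mono K 2 b e x = inj₁ refl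
  evalStep-mono K 3 b e x = inj₁ refl
  evalStep-mono K 4 b e x with O x in eq
  ... | zero  = inj₂ refl
  ... | suc v = inj₁ (cong (λ u → ifz u (evaluating K e x) (returning K (pred u))) (ext x eq))
  evalStep-mono K (suc (suc (suc (suc (suc t))))) b e x = inj₁ refl

  go : ∀ K m x → pair K (pair m x) ≡ st →
       stepAt O′ K m x ≡ stepAt O K m x ⊎ stepAt O K m x ≡ st
  go K zero    x eq = inj₁ refl
  go K (suc e) x eq with evalStep-mono K (left e) (right e) e x
  ... | inj₁ same  = inj₁ same
  ... | inj₂ stuck = inj₂ (trans stuck eq)

-- A waiting step is removed from the shorter run only, which preserves `t ≤ t′`. Once the shorter
-- run is used up, the final state is fixed under further steps.
run-mono : ∀ {O O′} → (∀ i {v} → O i ≡ suc v → O′ i ≡ suc v) →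
  ∀ t t′ st m → t ≤ t′ → run O t st ≡ returning 0 m → run O′ t′ st ≡ returning 0 m
run-mono {O} {O′} ext zero t′ st m le eq =
  trans (cong (run O′ t′) eq) (run-fixed O′ t′ (step-final O′ m))
run-mono {O} {O′} ext (suc t) (suc t′) st m le eq with step-mono {O} {O′} ext st
... | inj₁ same  = trans (cong (run O′ t′) same) (run-mono ext t t′ (step O st) m (≤-pred le) eq)
... | inj₂ stuck = run-mono ext t (suc t′) st m (m≤n⇒m≤1+n (≤-pred le))
                            (trans (sym (cong (run O t) stuck)) eq)

⌜++⌝ : ∀ σ τ → ⌜ σ ⌝ ≤ ⌜ σ ++ τ ⌝
⌜++⌝ []      τ = z≤n
⌜++⌝ (x ∷ σ) τ = s≤s (+-mono-≤ (triangle-mono (+-monoʳ-≤ x (⌜++⌝ σ τ))) (≤-refl {x}))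
  where
  triangle-mono : ∀ {m n} → m ≤ n → triangle m ≤ triangle n
  triangle-mono z≤n       = z≤n
  triangle-mono (s≤s m≤n) = s≤s (+-mono-≤ m≤n (triangle-mono m≤n))

⌜++⌝ʳ : ∀ σ τ → ⌜ τ ⌝ ≤ ⌜ σ ++ τ ⌝
⌜++⌝ʳ []      τ = ≤-refl
⌜++⌝ʳ (x ∷ σ) τ = m≤n⇒m≤1+n (≤-trans (⌜++⌝ʳ σ τ) (y≤pair x ⌜ σ ++ τ ⌝))

-- Extending the string enlarges both the oracle and, since prefixes have smaller codes, the number
-- of steps.
eval-++ : ∀ e σ τ n {m} → eval e σ n ≡ suc m → eval e (σ ++ τ) n ≡ suc m
eval-++ e σ τ n {m} eq = trans
  (cong result (run-mono (at-++ σ τ) ⌜ σ ⌝ _ (evaluating 0 e n) m (⌜++⌝ σ τ)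
    (result≡suc (run (at σ) ⌜ σ ⌝ (evaluating 0 e n)) eq)))
  (result-returning m)

-- A long initial segment answers every query of the halting computation, and its code, being at
-- least its length, allows for enough steps.
eval-complete : ∀ c {g n m} → ⟦ c ⟧ g n m →
  ∃ λ N → ∀ k → N ≤ k → eval (encode c) (g ↾ k) n ≡ suc m
eval-complete c {g} {n} {m} p = use r ⊔ steps r , λ k le → trans
  (cong result (run-mono {O = at (g ↾ k)} (λ _ eq → eq) (steps r) ⌜ g ↾ k ⌝
    (evaluating 0 (encode c) n) m
    (≤-trans (m≤n⊔m (use r) _) (≤-trans le
      (≤-trans (≤-reflexive (sym (length-applyUpTo g k))) (length≤⌜⌝ (g ↾ k)))))
    (run≡ r (at (g ↾ k)) (λ i i<u → at-↾ g k i (<-≤-trans i<u (≤-trans (m≤m⊔n _ _) le))))))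
  (result-returning m)
  where
  r = machine-complete c 0 p

-- Computability of the interpreter

atC : ∀ {q i} → Comp q → Comp i → Comp (λ n → at (list (q n)) (i n))
atC {q} {i} Q I = Comp-ext (λ n → eq (list (q n)) (i n))
  (ifzC (tailC Q I) zeroC (sucC ∘C leftC ∘C predC (tailC Q I)))
  where
  eq : ∀ σ i → ifz ⌜ drop i σ ⌝ 0 (suc (left (pred ⌜ drop i σ ⌝))) ≡ at σ i
  eq []      zero    = refl
  eq []      (suc i) = refl
  eq (x ∷ σ) zero    = cong suc (left-pair x ⌜ σ ⌝)
  eq (x ∷ σ) (suc i) = eq σ i

returningC : ∀ {K v} → Comp K → Comp v → Comp (λ n → returning (K n) (v n))
returningC K V = pairC K (pairC zeroC V)

evaluatingC : ∀ {K e x} → Comp K → Comp e → Comp x → Comp (λ n → evaluating (K n) (e n) (x n))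
evaluatingC K E X = pairC K (pairC (sucC ∘C E) X)

frameC : ∀ t {b K} → Comp b → Comp K → Comp (λ n → push (pair t (b n)) (K n))
frameC t B K = sucC ∘C pairC (pairC (constC t) B) K

-- A single step queries the oracle at `x n` at most. A constant oracle with the answer `o n`
-- therefore gives the same step.
evalStepC : ∀ {o K t b e x} (O : ℕ → ℕ → ℕ) → Comp o → (∀ n → o n ≡ O n (x n)) →
  Comp K → Comp t → Comp b → Comp e → Comp x →
  Comp (λ n → evalStep (O n) (K n) (t n) (b n) (e n) (x n))
evalStepC {o} {K′} {t′} {b′} {e′} {x′} O OC eq K T B E X = Comp-ext
  (λ n → cong (λ u → branches u (K′ n) (t′ n) (b′ n) (e′ n) (x′ n)) (eq n))
  (case 0 (returningC K zeroC)
  (case 1 (returningC K (sucC ∘C X))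
  (case 2 (returningC K (leftC ∘C X))
  (case 3 (returningC K (rightC ∘C X))
  (case 4 (ifzC OC (evaluatingC K E X) (returningC K (predC OC)))
  (case 5 (evaluatingC (frameC 0 (pairC (rightC ∘C B) X) K) (leftC ∘C B) X)
  (case 6 (evaluatingC (frameC 1 (leftC ∘C B) K) (rightC ∘C B) X)
  (case 7 (ifzC (rightC ∘C X) (evaluatingC K (leftC ∘C B) (leftC ∘C X))
            (evaluatingC (frameC 2 (pairC (rightC ∘C B) previous) K) E previous))
     (evaluatingC (frameC 3 (pairC B (pairC X zeroC)) K) B (pairC X zeroC))))))))))
  where
  case : ∀ k {f g} → Comp f → Comp g → Comp (λ n → ifz (t′ n ∸ k) (f n) (g n))
  case k = ifzC (∸C T (constC k))

  previous = pairC (leftC ∘C X) (predC (rightC ∘C X))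

  branches : ℕ → ℕ → ℕ → ℕ → ℕ → ℕ → ℕ
  branches o = evalStep (λ _ → o)

returnStepC : ∀ {K t b v} → Comp K → Comp t → Comp b → Comp v →
  Comp (λ n → returnStep (K n) (t n) (b n) (v n))
returnStepC {t = t′} K T B V =
   case 0 (evaluatingC (frameC 4 V K) (leftC ∘C B) (rightC ∘C B))
  (case 1 (evaluatingC K B V)
  (case 2 (evaluatingC K (leftC ∘C B)
            (pairC (leftC ∘C rightC ∘C B) (pairC (rightC ∘C rightC ∘C B) V)))
  (case 3 (ifzC V (returningC K (rightC ∘C rightC ∘C B))
            (evaluatingC (frameC 3 (pairC (leftC ∘C B) next′) K) (leftC ∘C B) next′))
          (returningC K (pairC B V)))))
  where
  case : ∀ k {f g} → Comp f → Comp g → Comp (λ n → ifz (t′ n ∸ k) (f n) (g n))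
  case k = ifzC (∸C T (constC k))

  next′ = pairC (leftC ∘C rightC ∘C B) (sucC ∘C rightC ∘C rightC ∘C B)

stepC : ∀ {q st} → Comp q → Comp st → Comp (λ n → step (at (list (q n))) (st n))
stepC {q} Q S = ifzC M
  (ifzC K (returningC zeroC X)
    (returnStepC (rightC ∘C predC K) (leftC ∘C leftC ∘C predC K) (rightC ∘C leftC ∘C predC K) X))
  (evalStepC (λ n → at (list (q n))) (atC Q X) (λ _ → refl)
    K (leftC ∘C predC M) (rightC ∘C predC M) (predC M) X)
  where
  K = leftC ∘C S
  M = leftC ∘C rightC ∘C S
  X = rightC ∘C rightC ∘C S

evalC : ∀ {e q n} → Comp e → Comp q → Comp n → Comp (λ w → eval (e w) (list (q w)) (n w))
evalC {e} {q} {n} E Q N = Comp-ext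
  (λ w → cong result (trans (eq (at (list (q w))) (q w) (evaluating 0 (e w) (n w)))
           (cong (λ k → run (at (list (q w))) k _) (sym (⌜list⌝ (q w))))))
  (ifzC (leftC ∘C R) (ifzC (leftC ∘C rightC ∘C R) (sucC ∘C rightC ∘C rightC ∘C R) zeroC) zeroC)
  where
  R : Comp (λ w → natrec (evaluating 0 (e w) (n w)) (λ _ → step (at (list (q w)))) (q w))
  R = natrecC (λ w _ → step (at (list (q w)))) (evaluatingC zeroC E N)
              (stepC (Q ∘C leftC) (rightC ∘C rightC)) Q

  eq : ∀ O t st → natrec st (λ _ → step O) t ≡ run O t st
  eq O zero    st = refl
  eq O (suc t) st = trans (cong (step O) (eq O t st)) (commute t st)
    where
    commute : ∀ t st → step O (run O t st) ≡ run O t (step O st)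
    commute zero    st = refl
    commute (suc t) st = commute t (step O st)

-- Unbounded search

least : ∀ {B : ℕ → Set} → (∀ i → Dec (B i)) → ∀ i → B i →
        ∃ λ j → B j × (∀ k → k < j → ¬ B k)
least B? zero    b = zero , b , λ _ ()
least B? (suc i) b with B? 0
... | yes b₀ = zero , b₀ , λ _ ()
... | no ¬b₀ = let j , bj , below = least (B? ∘ suc) i b in
  suc j , bj , λ { zero _ → ¬b₀ ; (suc k) k<j → below k (≤-pred k<j) }

searchC : (A : ℕ → ℕ → Set) → RecPred (λ w → A (left w) (right w)) → (∀ n → ∃ (A n)) →
          ∃ λ f → Comp f × (∀ n → A n (f n))
searchC A R total = proj₁ ∘ minimal , comp (muᶜ (code (char R̅))) found , proj₁ ∘ proj₂ ∘ minimal
  where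
  unpaired : ∀ n i → A (left (pair n i)) (right (pair n i)) ≡ A n i
  unpaired n i = cong₂ A (left-pair n i) (right-pair n i)

  -- `muᶜ` looks for a zero, and the characteristic function of the complement vanishes exactly on
  -- `A`.
  R̅ = ¬P R

  minimal : ∀ n → ∃ λ m → A n m × (∀ k → k < m → ¬ A n k)
  minimal n = least (λ i → subst Dec (unpaired n i) (dec R (pair n i)))
                    (proj₁ (total n)) (proj₂ (total n))

  value : ∀ w {v} → bit (does (dec R̅ w)) ≡ v → ⟦ code (char R̅) ⟧ _ w v
  value w refl = sound (char R̅) w

  found : ∀ n → ⟦ muᶜ (code (char R̅)) ⟧ _ n (proj₁ (minimal n))
  found n = let m , a , below = minimal n in
    value (pair n m)
      (cong bit (dec-false (dec R̅ _) (λ ¬a → ¬a (subst id (sym (unpaired n m)) a)))) ,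
    λ k k<m → 0 , value (pair n k)
      (cong bit (dec-true (dec R̅ _) (λ a → below k k<m (subst id (unpaired n k) a))))

-- Strings and their infinite extensions

shiftBy : ℕ → Baire → Baire
shiftBy m g i = g (m + i)

↾-cong : ∀ {f g} k → (∀ i → i < k → f i ≡ g i) → f ↾ k ≡ g ↾ k
↾-cong zero    eq = refl
↾-cong (suc k) eq = cong₂ _∷_ (eq 0 (s≤s z≤n)) (↾-cong k (λ i i<k → eq (suc i) (s≤s i<k)))

↾-+ : ∀ g m n → g ↾ (m + n) ≡ g ↾ m ++ shiftBy m g ↾ n
↾-+ g zero    n = refl
↾-+ g (suc m) n = cong (g 0 ∷_) (↾-+ (g ∘ suc) m n)

↾-≤ : ∀ g {m n} → m ≤ n → ∃ λ τ → g ↾ n ≡ g ↾ m ++ τ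
↾-≤ g {m} {n} m≤n = _ , trans (cong (g ↾_) (sym (m+[n∸m]≡n m≤n))) (↾-+ g m (n ∸ m))

⌢-↾ : ∀ σ f n → (σ ⌢ f) ↾ (length σ + n) ≡ σ ++ f ↾ n
⌢-↾ []      f n = refl
⌢-↾ (x ∷ σ) f n = cong (x ∷_) (⌢-↾ σ f n)

++-⌢ : ∀ σ τ f → (σ ++ τ) ⌢ f ≗ σ ⌢ (τ ⌢ f)
++-⌢ []      τ f n       = refl
++-⌢ (x ∷ σ) τ f zero    = refl
++-⌢ (x ∷ σ) τ f (suc n) = ++-⌢ σ τ f n

↾-⌢ : ∀ g m → g ≗ (g ↾ m) ⌢ shiftBy m g
↾-⌢ g zero    n       = refl
↾-⌢ g (suc m) zero    = refl
↾-⌢ g (suc m) (suc n) = ↾-⌢ (g ∘ suc) m n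

↾-split : ∀ g n π τ → g ↾ n ≡ π ++ τ → ∃ λ m →
  n ≡ length π + m × g ↾ length π ≡ π × shiftBy (length π) g ↾ m ≡ τ
↾-split g n       []      τ eq = n , refl , refl , eq
↾-split g (suc n) (x ∷ π) τ eq =
  let m , p , q , r = ↾-split (g ∘ suc) n π τ (cong (drop 1) eq)
  in m , cong suc p , cong₂ _∷_ (cong head₀ eq) q , r
  where
  head₀ : List ℕ → ℕ
  head₀ []      = 0
  head₀ (y ∷ _) = y

⌢-computable : ∀ σ {f} → Computable f → Computable (σ ⌢ f)
⌢-computable []      C = C
⌢-computable (x ∷ σ) {f} C = code C′ , sound C′
  where
  C₀ : Comp (σ ⌢ f)
  C₀ = let c , s = ⌢-computable σ C in comp c s

  C′ : Comp ((x ∷ σ) ⌢ f)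
  C′ = Comp-ext (λ { zero → refl ; (suc n) → refl }) (ifzC idC (constC x) (C₀ ∘C predC idC))

bounded : (f : ℕ → ℕ) → ∀ b → ∃ λ N → ∀ i → i < b → f i ≤ N
bounded f zero    = 0 , λ _ ()
bounded f (suc b) = let N , le = bounded f b in
  f b ⊔ N , λ i i<b → bound i N le (m≤n⇒m<n∨m≡n (≤-pred i<b))
  where
  bound : ∀ i N → (∀ i → i < b → f i ≤ N) → i < b ⊎ i ≡ b → f i ≤ f b ⊔ N
  bound i N le (inj₁ i<b)  = ≤-trans (le i i<b) (m≤n⊔m (f b) N)
  bound i N le (inj₂ refl) = m≤m⊔n (f i) N

-- Classical principles

module _ (lem : ExcludedMiddle 0ℓ) where

  ¬∀⇒∃¬ : ∀ {A : ℕ → Set} → ¬ (∀ n → A n) → ∃ λ n → ¬ A n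
  ¬∀⇒∃¬ {A} ¬∀ with lem {∃ λ n → ¬ A n}
  ... | yes ∃¬ = ∃¬
  ... | no ¬∃¬ = contradiction (λ n → Dec.decidable-stable lem (λ ¬a → ¬∃¬ (n , ¬a))) ¬∀

  -- If `A N` fails at `m₀`, it fails from there on, so the witnesses for `m ⊔ m₀` lie below `N`; by
  -- monotonicity they serve for `m` too.
  pigeonhole : ∀ N (A : ℕ → ℕ → Set) → (∀ i {m n} → m ≤ n → A i n → A i m) →
    (∀ m → ∃ λ i → i < N × A i m) → ∃ λ i → i < N × (∀ m → A i m)
  pigeonhole zero    A anti some with some 0
  ... | _ , () , _
  pigeonhole (suc N) A anti some with lem {∀ m → A N m}
  ... | yes all = N , ≤-refl , all
  ... | no ¬all =
    let m₀ , ¬a = ¬∀⇒∃¬ ¬all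
        i , i<N , all = pigeonhole N A anti (smaller m₀ ¬a)
    in i , m<n⇒m<1+n i<N , all
    where
    smaller : ∀ m₀ → ¬ A N m₀ → ∀ m → ∃ λ i → i < N × A i m
    smaller m₀ ¬a m with some (m ⊔ m₀)
    ... | i , i<1+N , a with m≤n⇒m<n∨m≡n (≤-pred i<1+N)
    ...   | inj₁ i<N  = i , i<N , anti i (m≤m⊔n m m₀) a
    ...   | inj₂ refl = contradiction (anti i (m≤n⊔m m m₀) a) ¬a

-- Computable trees, their leaves and the tree of Q

module _ (T : ComputableTree) where

  open ComputableTree T

  node-++ : ∀ σ τ → Node T (σ ++ τ) → Node T σ
  node-++ σ []      nd = subst (Node T) (++-identityʳ σ) nd
  node-++ σ (x ∷ τ) nd =
    closed x (node-++ (σ ∷ʳ x) τ (subst (Node T) (sym (++-assoc σ [ x ] τ)) nd))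

  paths-unbounded : ∀ {g} → (∀ n → ∃ λ m → n ≤ m × Node T (g ↾ m)) → g ∈ Paths T
  paths-unbounded {g} unb n =
    let m , n≤m , nd = unb n
        τ , eq = ↾-≤ g n≤m
    in node-++ (g ↾ n) τ (subst (Node T) eq nd)

  paths-resp : ∀ {f g} → f ≗ g → f ∈ Paths T → g ∈ Paths T
  paths-resp eq path n = subst (Node T) (↾-cong n (λ i _ → eq i)) (path n)

  nodeP : RecPred (λ n → Node T (list n))
  nodeP = recPred (λ n → member (list n) Bool.≟ true)
    (Comp-ext (λ n → eq (member (list n))) (comp (proj₁ computable)
      (λ n → subst (λ k → ⟦ proj₁ computable ⟧ _ k (bit (member (list n)))) (⌜list⌝ n)
                     (proj₂ computable (list n)))))
    where
    eq : ∀ b → bit b ≡ bit (does (b Bool.≟ true))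
    eq true  = refl
    eq false = refl

  childP : ∀ {x} → Comp x → RecPred (λ n → Node T (list n ∷ʳ x n))
  childP {x} X = RecPred-⇔ (λ n → subst (Node T) (list-⌜⌝ _))
                           (λ n → subst (Node T) (sym (list-⌜⌝ _)))
                           (nodeP ∘P ∷ʳC idC X)

  -- No node has an entry above 1, so two membership tests decide whether a node is a leaf.
  leaf-binary : ∀ {σ} → Node T σ → ¬ Node T (σ ∷ʳ 0) → ¬ Node T (σ ∷ʳ 1) → Leaf T σ
  leaf-binary {σ} nd ¬0 ¬1 = nd , λ
    { 0 → ¬0
    ; 1 → ¬1
    ; (suc (suc x)) nd′ → bad (++⁻ʳ σ (binary nd′)) }
    where
    bad : ∀ {x} → ¬ All (_< 2) [ suc (suc x) ]
    bad (s≤s (s≤s ()) All.∷ _)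

  leafP : RecPred (λ n → Leaf T (list n))
  leafP = RecPred-⇔ (λ n (nd , ¬0 , ¬1) → leaf-binary nd ¬0 ¬1)
                    (λ n (nd , ¬ch) → nd , ¬ch 0 , ¬ch 1)
                    (nodeP ∧P ¬P (childP (constC 0)) ∧P ¬P (childP (constC 1)))

  -- The chains and the set Q

  Good : ℕ → ℕ → List ℕ → Set
  Good e k σ = (∀ i → i < k → eval e σ i ≢ 0) × Node T (applyUpTo (pred ∘ eval e σ) k)

  -- The demanded output length is the code of `π`. It increases along the chain, so an infinite
  -- chain forces arbitrarily long outputs.
  Growth : ℕ → List ℕ → List ℕ → Set
  Growth b π σ = (∃ λ ρ → Leaf T ρ × σ ≡ π ++ ρ) × (∃ λ e → e < b × Good e ⌜ π ⌝ σ)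

  opaque
    growthP : RecPred (λ w → Growth (left w) (list (left (right w))) (list (right (right w))))
    growthP = extension ∧P ∃<P _ good leftC
      where
      extension : RecPred (λ w → ∃ λ ρ →
        Leaf T ρ × list (right (right w)) ≡ list (left (right w)) ++ ρ)
      -- A suffix has at most the code of the whole string, which bounds the search for `ρ`.
      extension = RecPred-⇔
        (λ w (i , _ , leaf , eq) → list i , leaf , trans (cong list eq) (list-⌜⌝ _))
        (λ w (ρ , leaf , eq) → ⌜ ρ ⌝ ,
          s≤s (≤-trans (⌜++⌝ʳ (list (left (right w))) ρ)
                (≤-reflexive (trans (cong ⌜_⌝ (sym eq)) (⌜list⌝ (right (right w)))))) ,
          subst (Leaf T) (sym (list-⌜⌝ ρ)) leaf ,
          trans (sym (⌜list⌝ (right (right w))))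
                (trans (cong ⌜_⌝ eq)
                       (cong (λ τ → ⌜ list (left (right w)) ++ τ ⌝) (sym (list-⌜⌝ ρ)))))
        (∃<P (λ w i → Leaf T (list i) × right (right w) ≡ ⌜ list (left (right w)) ++ list i ⌝)
          (leafP ∘P rightC ∧P
            ≡P (rightC ∘C rightC ∘C leftC) (++C (leftC ∘C rightC ∘C leftC) rightC))
          (sucC ∘C rightC ∘C rightC))

      good : RecPred (λ v →
        Good (right v) ⌜ list (left (right (left v))) ⌝ (list (right (right (left v)))))
      good = ∀<P _ (¬P (zeroP (evalC (rightC ∘C leftC) (σC ∘C leftC) rightC))) kC ∧P
        RecPred-⇔ (λ v → subst (Node T) (list-⌜⌝ _)) (λ v → subst (Node T) (sym (list-⌜⌝ _)))
          (nodeP ∘P applyUpToC (λ v i → pred (eval (right v) (list (right (right (left v)))) i))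
            (predC (evalC (rightC ∘C leftC) (σC ∘C leftC) rightC)) kC)
        where
        σC : Comp (λ v → right (right (left v)))
        σC = rightC ∘C rightC ∘C leftC

        kC : Comp (λ v → ⌜ list (left (right (left v))) ⌝)
        kC = Comp-ext (λ v → sym (⌜list⌝ _)) (leftC ∘C rightC ∘C leftC)

  -- The stages of a chain of strings that starts with list r: each string s is
  -- examined once, at stage s, and extensions have larger codes.
  grow : ℕ → ℕ → ℕ → ℕ
  grow r s p = ifz (bit (does (dec growthP (pair r (pair p s))))) p s

  stage : ℕ → ℕ → ℕ
  stage r = natrec r (grow r)

  chain : ℕ → ℕ → List ℕ
  chain r s = list (stage r s)

  stageC : ∀ {r s} → Comp r → Comp s → Comp (λ n → stage (r n) (s n))
  stageC {r} R S = natrecC (λ n → grow (r n)) R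
    (ifzC (char growthP ∘C pairC (R ∘C leftC) (pairC (rightC ∘C rightC) (leftC ∘C rightC)))
          (rightC ∘C rightC) (leftC ∘C rightC)) S

  stage-suc : ∀ r s →
    (stage r (suc s) ≡ s × Growth r (chain r s) (list s)) ⊎
    (stage r (suc s) ≡ stage r s × ¬ Growth r (chain r s) (list s))
  stage-suc r s = subst Step unpaired decide
    where
    p = stage r s
    w = pair r (pair p s)

    Step : Set → Set
    Step G = (stage r (suc s) ≡ s × G) ⊎ (stage r (suc s) ≡ p × ¬ G)

    G′ = Growth (left w) (list (left (right w))) (list (right (right w)))

    unpaired : G′ ≡ Growth r (list p) (list s)
    unpaired rewrite unpair-pair r (pair p s) | unpair-pair p s = refl

    decide : Step G′
    decide with dec growthP w
    ... | yes g = inj₁ (refl , g)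
    ... | no ¬g = inj₂ (refl , ¬g)

  chain-step : ∀ r s → ∃ λ ρ → chain r (suc s) ≡ chain r s ++ ρ
  chain-step r s with stage-suc r s
  ... | inj₁ (eq , (ρ , _ , eq′) , _) = ρ , trans (cong list eq) eq′
  ... | inj₂ (eq , _) = [] , trans (cong list eq) (sym (++-identityʳ (chain r s)))

  chain-+ : ∀ r s k → ∃ λ ρ → chain r (k + s) ≡ chain r s ++ ρ
  chain-+ r s zero    = [] , sym (++-identityʳ (chain r s))
  chain-+ r s (suc k) =
    let ρ , eq = chain-+ r s k
        τ , eq′ = chain-step r (k + s)
    in ρ ++ τ , trans eq′ (trans (cong (_++ τ) eq) (++-assoc (chain r s) ρ τ))

  chain-mono : ∀ r {s s′} → s ≤ s′ → ∃ λ ρ → chain r s′ ≡ chain r s ++ ρ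
  chain-mono r {s} {s′} s≤s′ =
    subst (λ u → ∃ λ ρ → chain r u ≡ chain r s ++ ρ) (m∸n+n≡m s≤s′) (chain-+ r s (s′ ∸ s))

  ⌜chain⌝ : ∀ r s → ⌜ chain r s ⌝ ≡ stage r s
  ⌜chain⌝ r s = ⌜list⌝ (stage r s)

  stage-mono : ∀ r {s s′} → s ≤ s′ → stage r s ≤ stage r s′
  stage-mono r {s} {s′} s≤s′ = let ρ , eq = chain-mono r s≤s′ in
    subst₂ _≤_ (⌜chain⌝ r s) (trans (cong ⌜_⌝ (sym eq)) (⌜chain⌝ r s′)) (⌜++⌝ (chain r s) ρ)

  -- A value `p` other than the initial one is adopted at stage `suc p`. This bounds the stages that
  -- have to be inspected when membership in the tree of Q is decided.
  stage-early : ∀ r s → ∃ λ s′ → s′ ≤ suc (stage r s) × stage r s′ ≡ stage r s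
  stage-early r zero = zero , z≤n , refl
  stage-early r (suc s) with stage-suc r s
  ... | inj₁ (eq , _) = suc s , s≤s (≤-reflexive (sym eq)) , refl
  ... | inj₂ (eq , _) = let s′ , le , eq′ = stage-early r s in
    s′ , subst (λ u → s′ ≤ suc u) (sym eq) le , trans eq′ (sym eq)

  InQ : List ℕ → Set
  InQ σ = Node T σ ⊎ ∃ λ r → ∃ λ s → ∃ λ τ → Leaf T (list r) × Node T τ × σ ≡ chain r s ++ τ

  -- The last entry is taken from `τ`. If `τ` is empty, the leaf added last to the chain becomes the
  -- new `τ` at the preceding stage; at stage 0 the string is itself a leaf of `T`.
  InQ-∷ʳ : ∀ σ x → InQ (σ ∷ʳ x) → InQ σ
  InQ-∷ʳ σ x (inj₁ nd) = inj₁ (closed x nd)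
  InQ-∷ʳ σ x (inj₂ (r , s , τ , leaf , nd , eq)) = go s τ nd eq
    where
    fromLeaf : σ ∷ʳ x ≡ list r → InQ σ
    fromLeaf eq = inj₁ (closed x (subst (Node T) (sym eq) (proj₁ leaf)))

    go : ∀ s τ → Node T τ → σ ∷ʳ x ≡ chain r s ++ τ → InQ σ
    go s τ nd eq with initLast τ
    go s .(τ ∷ʳ y) nd eq | τ ∷ʳ′ y = inj₂ (r , s , τ , leaf , closed y nd ,
      ∷ʳ-injectiveˡ σ (chain r s ++ τ) (trans eq (sym (++-assoc (chain r s) τ [ y ]))))
    go zero    .[] nd eq | [] = fromLeaf (trans eq (++-identityʳ (list r)))
    go (suc s) .[] nd eq | [] with stage-suc r s
    ... | inj₂ (same , _) = go s [] nd (trans eq (cong (λ u → list u ++ []) same))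
    ... | inj₁ (new , (ρ , leafρ , eq′) , _) = go s ρ (proj₁ leafρ)
      (trans eq (trans (++-identityʳ (chain r (suc s))) (trans (cong list new) eq′)))

  leaf-chain : ∀ r → Leaf T (list r) → ∀ s → All (_< 2) (chain r s)
  leaf-chain r leaf zero = binary (proj₁ leaf)
  leaf-chain r leaf (suc s) with stage-suc r s
  ... | inj₂ (same , _) = subst (All (_< 2) ∘ list) (sym same) (leaf-chain r leaf s)
  ... | inj₁ (new , (ρ , leafρ , eq) , _) =
    subst (All (_< 2)) (sym (trans (cong list new) eq))
          (++⁺ (leaf-chain r leaf s) (binary (proj₁ leafρ)))

  opaque
    -- All quantifiers can be bounded by the code `n` of the string: `r` and the code of the chain
    -- are at most `n` because prefixes have smaller codes, the stage is at most `suc n` by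
    -- `stage-early`, and `τ` is a suffix.
    inQP : RecPred (λ n → InQ (list n))
    inQP = nodeP ∨P RecPred-⇔ to from
      (∃<P (λ n r → ∃ λ s → s < suc (suc n) × ∃ λ τ → τ < suc n × Matrix n r s τ)
        (∃<P (λ u s → ∃ λ τ → τ < suc (left u) × Matrix (left u) (right u) s τ)
          (∃<P (λ v τ → Matrix (left (left v)) (right (left v)) (right v) τ) matrixP
            (sucC ∘C leftC ∘C leftC))
          (sucC ∘C sucC ∘C leftC))
        sucC)
      where
      Matrix : ℕ → ℕ → ℕ → ℕ → Set
      Matrix n r s τ = Leaf T (list r) × Node T (list τ) × n ≡ ⌜ chain r s ++ list τ ⌝

      matrixP : RecPred (λ w → Matrix (left (left (left w))) (right (left (left w)))
                                      (right (left w)) (right w))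
      matrixP = leafP ∘P rC ∧P nodeP ∘P rightC ∧P
        ≡P (leftC ∘C leftC ∘C leftC) (++C (stageC rC (rightC ∘C leftC)) rightC)
        where
        rC : Comp (λ w → right (left (left w)))
        rC = rightC ∘C leftC ∘C leftC

      to : ∀ n →
           (∃ λ r → r < suc n × ∃ λ s → s < suc (suc n) × ∃ λ τ → τ < suc n × Matrix n r s τ) →
           ∃ λ r → ∃ λ s → ∃ λ τ → Leaf T (list r) × Node T τ × list n ≡ chain r s ++ τ
      to n (r , _ , s , _ , τ , _ , leaf , nd , eq) =
        r , s , list τ , leaf , nd , trans (cong list eq) (list-⌜⌝ _)

      from : ∀ n →
             (∃ λ r → ∃ λ s → ∃ λ τ → Leaf T (list r) × Node T τ × list n ≡ chain r s ++ τ) →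
             ∃ λ r → r < suc n × ∃ λ s → s < suc (suc n) × ∃ λ τ → τ < suc n × Matrix n r s τ
      from n (r , s , τ , leaf , nd , eq) =
        let s′ , s′≤ , same = stage-early r s in
        r , s≤s (≤-trans (stage-mono r {0} {s} z≤n) stage≤n) ,
        s′ , s≤s (≤-trans s′≤ (s≤s stage≤n)) ,
        ⌜ τ ⌝ , s≤s (≤-trans (⌜++⌝ʳ (chain r s) τ) (≤-reflexive (sym n≡))) ,
        leaf , subst (Node T) (sym (list-⌜⌝ τ)) nd ,
        trans n≡ (cong₂ (λ p q → ⌜ list p ++ q ⌝) (sym same) (sym (list-⌜⌝ τ)))
        where
        n≡ : n ≡ ⌜ chain r s ++ τ ⌝
        n≡ = trans (sym (⌜list⌝ n)) (cong ⌜_⌝ eq)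

        stage≤n : stage r s ≤ n
        stage≤n = subst₂ _≤_ (⌜chain⌝ r s) (sym n≡) (⌜++⌝ (chain r s) τ)

  inQ? : ∀ σ → Dec (InQ (list ⌜ σ ⌝))
  inQ? σ = dec inQP ⌜ σ ⌝

  inQ⇒member : ∀ σ → InQ σ → does (inQ? σ) ≡ true
  inQ⇒member σ q = dec-true (inQ? σ) (subst InQ (sym (list-⌜⌝ σ)) q)

  member⇒inQ : ∀ σ → does (inQ? σ) ≡ true → InQ σ
  member⇒inQ σ eq with inQ? σ
  ... | yes q = subst InQ (list-⌜⌝ σ) q

  treeQ : ComputableTree
  treeQ = record
    { member     = λ σ → does (inQ? σ)
    ; computable = code (char inQP) , λ σ → sound (char inQP) ⌜ σ ⌝
    ; binary     = λ {σ} eq → inQ-binary (member⇒inQ σ eq)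
    ; closed     = λ {σ} x eq → inQ⇒member σ (InQ-∷ʳ σ x (member⇒inQ (σ ∷ʳ x) eq))
    }
    where
    inQ-binary : ∀ {σ} → InQ σ → All (_< 2) σ
    inQ-binary (inj₁ nd) = binary nd
    inQ-binary (inj₂ (r , s , τ , leaf , nd , refl)) = ++⁺ (leaf-chain r leaf s) (binary nd)

  paths⊆Q : Paths T ⊆ Paths treeQ
  paths⊆Q {f} path n = inQ⇒member (f ↾ n) (inj₁ (path n))

-- Continuations of chains in Q and in ▽P

module _ (T : ComputableTree) where

  chain⌢paths⊆Q : ∀ r s → Leaf T (list r) → ∀ {f} → f ∈ Paths T →
    (chain T r s ⌢ f) ∈ Paths (treeQ T)
  chain⌢paths⊆Q r s leaf {f} path = paths-unbounded (treeQ T) λ n →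
    length (chain T r s) + n , m≤n+m n _ ,
    inQ⇒member T _ (inj₂ (r , s , f ↾ n , leaf , path n , ⌢-↾ (chain T r s) f n))

  iterate-resp : ∀ {P} → P ≐ Paths T → ∀ n {f g} → f ≗ g →
    f ∈ iterate⌢ T P n → g ∈ iterate⌢ T P n
  iterate-resp (to , from) zero    eq p = from (paths-resp T eq (to p))
  iterate-resp (to , from) (suc n) eq (inj₁ p) = inj₁ (from (paths-resp T eq (to p)))
  iterate-resp _ (suc n) eq (inj₂ (ρ , leaf , f , q , eq′)) =
    inj₂ (ρ , leaf , f , q , λ i → trans (sym (eq i)) (eq′ i))

  -- Induction on the stage. Undoing a growth step moves one leaf from the chain into the tail,
  -- which costs one more iteration of the concatenation.
  chain⌢▽ : ∀ {P} → P ≐ Paths T → ∀ r → Leaf T (list r) → ∀ s n {f g} → f ∈ iterate⌢ T P n →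
            g ≗ chain T r s ⌢ f → g ∈ ▽ T P
  chain⌢▽ P≐ r leaf zero n f∈ eq = suc n , inj₂ (list r , leaf , _ , f∈ , eq)
  chain⌢▽ P≐ r leaf (suc s) n {f} f∈ eq with stage-suc T r s
  ... | inj₂ (same , _) = chain⌢▽ P≐ r leaf s n f∈ λ i →
    trans (eq i) (cong (λ u → (list u ⌢ f) i) same)
  ... | inj₁ (new , (ρ , leafρ , eq′) , _) =
    chain⌢▽ P≐ r leaf s (suc n) (inj₂ (ρ , leafρ , f , f∈ , λ _ → refl)) λ i →
      trans (eq i) (trans (cong (λ σ → (σ ⌢ f) i) (trans (cong list new) eq′))
                          (++-⌢ (chain T r s) ρ f i))

-- Consequences of the absence of computable paths

module _ (lem : ExcludedMiddle 0ℓ) (T : ComputableTree) (special : Special (Paths T)) where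

  open ComputableTree T

  -- Some path passes through the root. Hence leaves are nonempty, and appending one makes a string
  -- strictly longer.
  root-not-leaf : ¬ Leaf T []
  root-not-leaf (_ , ¬child) = let f , path = proj₁ special in ¬child (f 0) (path 1)

  -- Above a node without leaves, the path that goes left whenever it can is computable.
  leaf-above : ∀ τ → Node T τ → ∃ λ ρ → Leaf T (τ ++ ρ)
  leaf-above τ nd = Dec.decidable-stable lem λ ¬leaf →
    proj₂ special (leftmost-path ¬leaf) (⌢-computable τ (code digitC , sound digitC))
    where
    left? : ∀ q → Dec (Node T (list q ∷ʳ 0))
    left? = dec (childP T zeroC)

    turn : ℕ → ℕ
    turn q = 1 ∸ bit (does (left? q))

    turnC : Comp turn
    turnC = ∸C (constC 1) (char (childP T zeroC))

    walk : ℕ → ℕ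
    walk = natrec ⌜ τ ⌝ (λ _ q → ⌜ list q ∷ʳ turn q ⌝)

    digit : Baire
    digit n = turn (walk n)

    digitC : Comp digit
    digitC = turnC ∘C natrecC (λ _ _ q → ⌜ list q ∷ʳ turn q ⌝) (constC ⌜ τ ⌝)
      (∷ʳC (rightC ∘C rightC) (turnC ∘C rightC ∘C rightC)) idC

    walk-digits : ∀ n → list (walk n) ≡ τ ++ digit ↾ n
    walk-digits zero    = trans (list-⌜⌝ τ) (sym (++-identityʳ τ))
    walk-digits (suc n) = trans (list-⌜⌝ _) (trans (cong (_∷ʳ digit n) (walk-digits n))
      (trans (++-assoc τ (digit ↾ n) [ digit n ]) (cong (τ ++_) (applyUpTo-∷ʳ digit n))))

    module _ (¬leaf : ¬ ∃ λ ρ → Leaf T (τ ++ ρ)) where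

      turn-node : ∀ σ (d : Dec (Node T (σ ∷ʳ 0))) ρ → σ ≡ τ ++ ρ → Node T σ →
                  Node T (σ ∷ʳ (1 ∸ bit (does d)))
      turn-node σ (yes nd₀) ρ eq nd = nd₀
      turn-node σ (no ¬nd₀) ρ eq nd = Dec.decidable-stable lem λ ¬nd₁ →
        ¬leaf (ρ , subst (Leaf T) eq (leaf-binary T nd ¬nd₀ ¬nd₁))

      walk-node : ∀ n → Node T (list (walk n))
      walk-node zero    = subst (Node T) (sym (list-⌜⌝ τ)) nd
      walk-node (suc n) = subst (Node T) (sym (list-⌜⌝ _))
        (turn-node (list (walk n)) (left? (walk n)) (digit ↾ n) (walk-digits n) (walk-node n))

      leftmost-path : (τ ⌢ digit) ∈ Paths T
      leftmost-path = paths-unbounded T λ n → length τ + n , m≤n+m n _ ,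
        subst (Node T) (trans (walk-digits n) (sym (⌢-↾ τ digit n))) (walk-node n)

  -- A leaf above the first `b` entries of a path has length at least `b`, and codes bound lengths.
  leaf-above-bound : ∀ b → ∃ λ r → b ≤ r × Leaf T (list r)
  leaf-above-bound b =
    let f , path = proj₁ special
        ρ , leaf = leaf-above (f ↾ b) (path b)
    in ⌜ f ↾ b ++ ρ ⌝ ,
       ≤-trans (≤-reflexive (sym (length-applyUpTo f b)))
               (≤-trans (length≤⌜⌝ (f ↾ b)) (⌜++⌝ (f ↾ b) ρ)) ,
       subst (Leaf T) (sym (list-⌜⌝ _)) leaf

  good-mono : ∀ {e k k′ σ} → k ≤ k′ → Good T e k′ σ → Good T e k σ
  good-mono {e} {k} {σ = σ} k≤k′ (defined , nd) =
    (λ i i<k → defined i (<-≤-trans i<k k≤k′)) ,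
    let τ , eq = ↾-≤ (pred ∘ eval e σ) k≤k′ in node-++ T _ τ (subst (Node T) eq nd)

  Moves : ℕ → ℕ → ℕ → Set
  Moves r e s = stage T r (suc s) ≡ s × Good T e (stage T r s) (list s)

  -- The outputs of e along an infinite chain form a computable path.
  ¬moves-forever : ∀ r e → ¬ (∀ m → ∃ λ s → m ≤ s × Moves r e s)
  ¬moves-forever r e forever = proj₂ special path (code xC , sound xC)
    where
    output : ℕ → ℕ → ℕ
    output s n = eval e (chain T r s) n

    -- The first move, at a stage `s₁ ≥ k`, gives the chain the code `s₁`; the next move then has to
    -- produce at least `k` values.
    good-stage : ∀ k → ∃ λ s → Good T e k (chain T r s)
    good-stage k =
      let s₁ , k≤s₁ , new₁ , _ = forever k
          s₂ , s₁<s₂ , new₂ , good = forever (suc s₁)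
          s₁≤stage = subst (_≤ stage T r s₂) new₁ (stage-mono T r s₁<s₂)
      in suc s₂ , subst (Good T e k ∘ list) (sym new₂)
                        (good-mono {e} {σ = list s₂} (≤-trans k≤s₁ s₁≤stage) good)

    found : ∃ λ f → Comp f × (∀ n → output (f n) n ≢ 0)
    found = searchC (λ n s → output s n ≢ 0)
      (¬P (zeroP (evalC (constC e) (stageC T (constC r) rightC) leftC)))
      (λ n → let s , defined , _ = good-stage (suc n) in s , defined n ≤-refl)

    at-stage : ℕ → ℕ
    at-stage = proj₁ found

    x : Baire
    x n = pred (output (at-stage n) n)

    xC : Comp x
    xC = predC (evalC (constC e) (stageC T (constC r) (proj₁ (proj₂ found))) idC)

    -- Later strings of the chain extend earlier ones, so the outputs found at different stages fit
    -- together into one path.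
    output-mono : ∀ n {s s′} → s ≤ s′ → output s n ≢ 0 → output s′ n ≡ output s n
    output-mono n {s} {s′} s≤s′ ≢0 with output s n in eq | chain-mono T r s≤s′
    ... | zero  | _ = contradiction refl ≢0
    ... | suc v | ρ , eq′ = trans (cong (λ σ → eval e σ n) eq′) (eval-++ e (chain T r s) ρ n eq)

    output-unique : ∀ n s s′ → output s n ≢ 0 → output s′ n ≢ 0 → output s n ≡ output s′ n
    output-unique n s s′ ≢0 ≢0′ with ≤-total s s′
    ... | inj₁ s≤s′ = sym (output-mono n s≤s′ ≢0)
    ... | inj₂ s′≤s = output-mono n s′≤s ≢0′

    path : x ∈ Paths T
    path k = let s , defined , nd = good-stage k in
      subst (Node T) (↾-cong k (λ i i<k → cong pred
        (output-unique i s (at-stage i) (defined i i<k) (proj₂ (proj₂ found) i)))) nd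

  -- If moves occurred at arbitrarily late stages, the pigeonhole principle would give one program
  -- below `r` responsible for arbitrarily late moves, which `¬moves-forever` excludes.
  chain-stable : ∀ r → ∃ λ s₀ → ∀ s → s₀ ≤ s → stage T r s ≡ stage T r s₀
  chain-stable r with lem {∃ λ s₀ → ∀ s → s₀ ≤ s → ¬ (∃ λ e → e < r × Moves r e s)}
  ... | yes (s₀ , still) = s₀ , λ s s₀≤s →
    subst (λ u → stage T r u ≡ stage T r s₀) (m∸n+n≡m s₀≤s) (constant (s ∸ s₀))
    where
    constant : ∀ k → stage T r (k + s₀) ≡ stage T r s₀
    constant zero = refl
    constant (suc k) with stage-suc T r (k + s₀)
    ... | inj₂ (same , _) = trans same (constant k)
    ... | inj₁ (new , _ , e , e<r , good) = contradiction
      (e , e<r , new , subst (λ u → Good T e u (list (k + s₀))) (⌜chain⌝ T r (k + s₀)) good)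
      (still (k + s₀) (m≤n+m s₀ k))
  ... | no ¬still =
    let e , _ , forever = pigeonhole lem r (λ e m → ∃ λ s → m ≤ s × Moves r e s)
          (λ e m≤n (s , n≤s , mv) → s , ≤-trans m≤n n≤s , mv) moves
    in contradiction forever (¬moves-forever r e)
    where
    moves : ∀ m → ∃ λ e → e < r × ∃ λ s → m ≤ s × Moves r e s
    moves m = Dec.decidable-stable lem λ ¬move → ¬still
      (m , λ s m≤s (e , e<r , mv) → ¬move (e , e<r , s , m≤s , mv))

  -- Suppose `g` leaves `T` at `n₀`. Its long initial segments split into a chain and a node, and
  -- the leaf starting the chain is `g ↾ j` for some `j < n₀`. The pigeonhole principle fixes `j`,
  -- then, since the chain becomes stable, also the stage; what remains of `g` is a path.
  Q⊆▽ : ∀ {P} → P ≐ Paths T → Paths (treeQ T) ⊆ ▽ T P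
  Q⊆▽ P≐@(_ , from) {g} g∈Q with lem {g ∈ Paths T}
  ... | yes path = 0 , from path
  ... | no ¬path =
    let n₀ , ¬node = ¬∀⇒∃¬ lem ¬path
        j , j<n₀ , splits = pigeonhole lem n₀
          (λ j m → ∃ λ n → m ≤ n × Splits j n) anti (λ m → split-at n₀ ¬node m)
        leaf = proj₁ (proj₂ (proj₂ (splits 0)))
        s₀ , stable = chain-stable ⌜ g ↾ j ⌝
        s , _ , tails = pigeonhole lem (suc s₀)
          (λ s m → ∃ λ n → m ≤ n × SplitsAt ⌜ g ↾ j ⌝ s n)
          (λ s m≤n (k , n≤k , sp) → k , ≤-trans m≤n n≤k , sp)
          (λ m → early ⌜ g ↾ j ⌝ s₀ stable m (splits m))
        _ , path , eq = tail-path ⌜ g ↾ j ⌝ s tails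
    in chain⌢▽ T P≐ ⌜ g ↾ j ⌝ leaf s 0 (from path) eq
    where
    SplitsAt : ℕ → ℕ → ℕ → Set
    SplitsAt r s n = ∃ λ τ → Node T τ × g ↾ n ≡ chain T r s ++ τ

    Splits : ℕ → ℕ → Set
    Splits j n = Leaf T (list ⌜ g ↾ j ⌝) × ∃ λ s → SplitsAt ⌜ g ↾ j ⌝ s n

    anti : ∀ j {m n} → m ≤ n → (∃ λ k → n ≤ k × Splits j k) → ∃ λ k → m ≤ k × Splits j k
    anti j m≤n (k , n≤k , sp) = k , ≤-trans m≤n n≤k , sp

    split-at : ∀ n₀ → ¬ Node T (g ↾ n₀) → ∀ m → ∃ λ j → j < n₀ × ∃ λ n → m ≤ n × Splits j n
    split-at n₀ ¬node m with member⇒inQ T (g ↾ (m + n₀)) (g∈Q (m + n₀))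
    ... | inj₁ nd = let τ , eq = ↾-≤ g (m≤n+m n₀ m) in
      contradiction (node-++ T _ τ (subst (Node T) eq nd)) ¬node
    ... | inj₂ (r , s , τ , leaf , nd , eq) =
      length (list r) , j<n₀ , m + n₀ , m≤m+n m n₀ ,
      subst (Leaf T ∘ list) r≡ leaf , s , τ , nd , trans eq (cong (λ u → chain T u s ++ τ) r≡)
      where
      j = length (list r)

      r-prefix : g ↾ j ≡ list r
      r-prefix = let ρ , eq′ = chain-mono T r {0} {s} z≤n in
        proj₁ (proj₂ (proj₂ (↾-split g (m + n₀) (list r) (ρ ++ τ)
          (trans eq (trans (cong (_++ τ) eq′) (++-assoc (list r) ρ τ))))))

      r≡ : r ≡ ⌜ g ↾ j ⌝
      r≡ = trans (sym (⌜list⌝ r)) (cong ⌜_⌝ (sym r-prefix))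

      -- Otherwise `g ↾ n₀` would be a prefix of the leaf `list r` and hence a node.
      j<n₀ : j < n₀
      j<n₀ with j <? n₀
      ... | yes lt = lt
      ... | no ¬lt = let ρ , eq′ = ↾-≤ g (≮⇒≥ ¬lt) in contradiction
        (node-++ T _ ρ (subst (Node T) eq′ (subst (Node T) (sym r-prefix) (proj₁ leaf)))) ¬node

    early : ∀ r s₀ → (∀ s → s₀ ≤ s → stage T r s ≡ stage T r s₀) → ∀ m →
      (∃ λ n → m ≤ n × Leaf T (list r) × ∃ λ s → SplitsAt r s n) →
      ∃ λ s → s < suc s₀ × ∃ λ n → m ≤ n × SplitsAt r s n
    early r s₀ stable m (n , m≤n , _ , s , τ , nd , eq) with ≤-total s s₀
    ... | inj₁ s≤s₀ = s , s≤s s≤s₀ , n , m≤n , τ , nd , eq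
    ... | inj₂ s₀≤s = s₀ , ≤-refl , n , m≤n , τ , nd ,
      trans eq (cong (λ u → list u ++ τ) (stable s s₀≤s))

    tail-path : ∀ r s → (∀ m → ∃ λ n → m ≤ n × SplitsAt r s n) →
      ∃ λ f → f ∈ Paths T × g ≗ chain T r s ⌢ f
    tail-path r s tails = shiftBy (length π) g , paths-unbounded T unbounded ,
      λ i → trans (↾-⌢ g (length π) i) (cong (λ σ → (σ ⌢ shiftBy (length π) g) i) π-prefix)
      where
      π = chain T r s

      π-prefix : g ↾ length π ≡ π
      π-prefix = let n , _ , τ , _ , eq = tails 0 in proj₁ (proj₂ (proj₂ (↾-split g n π τ eq)))

      unbounded : ∀ k → ∃ λ m → k ≤ m × Node T (shiftBy (length π) g ↾ m)
      unbounded k =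
        let n , le , τ , nd , eq = tails (length π + k)
            m , n≡ , _ , τ≡ = ↾-split g n π τ eq
        in m , +-cancelˡ-≤ (length π) k m (≤-trans le (≤-reflexive n≡)) ,
           subst (Node T) (sym τ≡) nd

  -- The first `⌜ π ⌝` values of `h` use only a finite part of the oracle. Extending this part to
  -- `π` followed by a leaf gives a string `σ` by which the chain must grow at stage `⌜ σ ⌝`,
  -- contrary to its stability.
  stable-chain-diagonal : ∀ r s₀ → (∀ s → s₀ ≤ s → stage T r s ≡ stage T r s₀) →
    ∀ p → encode p < r → ∀ {f h} → f ∈ Paths T → h ∈ Paths T →
    ¬ (∀ n → ⟦ p ⟧ (chain T r s₀ ⌢ f) n (h n))
  stable-chain-diagonal r s₀ stable p c<r {f} {h} path h-path computes =
    absurd (stage-suc T r ⌜ σ ⌝)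
    where
    π = chain T r s₀
    c = encode p

    defined-from : ℕ → ℕ
    defined-from i = proj₁ (eval-complete p (computes i))

    bound : ∃ λ M → ∀ i → i < ⌜ π ⌝ → defined-from i ≤ M
    bound = bounded defined-from ⌜ π ⌝

    -- The first bound covers the oracle use and running times; `s₀` ensures that `σ` is examined
    -- after the chain has become stable.
    m = proj₁ bound ⊔ s₀

    ρ-leaf : ∃ λ ρ → Leaf T (f ↾ m ++ ρ)
    ρ-leaf = leaf-above (f ↾ m) (path m)

    ρ = f ↾ m ++ proj₁ ρ-leaf

    σ = π ++ ρ

    outputs : ∀ i → i < ⌜ π ⌝ → eval c σ i ≡ suc (h i)
    outputs i i<k = trans
      (cong (λ τ → eval c τ i) (sym (++-assoc π (f ↾ m) (proj₁ ρ-leaf))))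
      (eval-++ c (π ++ f ↾ m) (proj₁ ρ-leaf) i (trans
        (cong (λ τ → eval c τ i) (sym (⌢-↾ π f m)))
        (proj₂ (eval-complete p (computes i)) (length π + m)
          (≤-trans (proj₂ bound i i<k) (≤-trans (m≤m⊔n _ s₀) (m≤n+m m _))))))

    good : Good T c ⌜ π ⌝ σ
    good = (λ i i<k eq → 0≢1+n (trans (sym eq) (outputs i i<k))) ,
      subst (Node T) (sym (↾-cong ⌜ π ⌝ (λ i i<k → cong pred (outputs i i<k)))) (h-path ⌜ π ⌝)

    s₀≤σ : s₀ ≤ ⌜ σ ⌝
    s₀≤σ = ≤-trans (m≤n⊔m (proj₁ bound) s₀)
      (≤-trans (≤-reflexive (sym (length-applyUpTo f m)))
      (≤-trans (length≤⌜⌝ (f ↾ m))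
      (≤-trans (⌜++⌝ (f ↾ m) (proj₁ ρ-leaf)) (⌜++⌝ʳ π ρ))))

    absurd : (stage T r (suc ⌜ σ ⌝) ≡ ⌜ σ ⌝ × Growth T r (chain T r ⌜ σ ⌝) (list ⌜ σ ⌝)) ⊎
      (stage T r (suc ⌜ σ ⌝) ≡ stage T r ⌜ σ ⌝ × ¬ Growth T r (chain T r ⌜ σ ⌝) (list ⌜ σ ⌝)) → ⊥
    -- If `σ` is adopted, stability forces `π ≡ σ`, so the appended leaf would be empty.
    absurd (inj₁ (new , _)) =
      root-not-leaf (subst (Leaf T) (++-identityʳ-unique π π≡σ) (proj₂ ρ-leaf))
      where
      π≡σ : π ≡ σ
      π≡σ = trans (cong list (trans (sym (stable _ (m≤n⇒m≤1+n s₀≤σ))) new)) (list-⌜⌝ σ)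
    absurd (inj₂ (_ , ¬growth)) = ¬growth
      (subst₂ (Growth T r) (cong list (sym (stable _ s₀≤σ))) (sym (list-⌜⌝ σ))
        ((ρ , proj₂ ρ-leaf , refl) , c , c<r , good))

  -- The set `X` is only assumed to contain the continuations of chains, so that both Q and ▽P can
  -- take its place.
  irreducible : ∀ {P X : Pred Baire 0ℓ} → P ≐ Paths T →
    (∀ r s → Leaf T (list r) → ∀ {f} → f ∈ Paths T → (chain T r s ⌢ f) ∈ X) →
    ¬ (P ≤[ ⟨<ω,1⟩-computable ] X)
  irreducible (to , _) chains∈X (Γ , (b , finite) , total , maps) =
    -- The interpreter runs the canonical index `encode (decode e)`, which may differ from `e`;
    -- hence the bound is taken over these indices.
    let N , encode≤N = bounded (encode ∘ decode) b
        r , N<r , leaf = leaf-above-bound (suc N)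
        s₀ , stable = chain-stable r
        f , path = proj₁ special
        g∈X = chains∈X r s₀ leaf path
        h , graph = total g∈X
        e , e<b , computes = finite graph
    in stable-chain-diagonal r s₀ stable (decode e) (<-≤-trans (s≤s (encode≤N e e<b)) N<r)
         path (to (maps g∈X graph)) computes

-- Reductions between P, Q and ▽P

shiftᶜ : ℕ → Code
shiftᶜ zero    = oracleᶜ
shiftᶜ (suc j) = compᶜ (shiftᶜ j) succᶜ

shiftᶜ-sound : ∀ j g n → ⟦ shiftᶜ j ⟧ g n (shiftBy j g n)
shiftᶜ-sound zero    g n = refl
shiftᶜ-sound (suc j) g n = suc n , refl ,
  subst (λ i → ⟦ shiftᶜ j ⟧ g (suc n) (g i)) (+-suc j n) (shiftᶜ-sound j g (suc n))

encode-shiftC : ∀ {f} → Comp f → Comp (λ n → encode (shiftᶜ (f n)))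
encode-shiftC {f} F = Comp-ext (λ n → eq (f n))
  (natrecC (λ _ _ r → pair 6 (pair r (encode succᶜ))) (constC (encode oracleᶜ))
    (pairC (constC 6) (pairC (rightC ∘C rightC) (constC (encode succᶜ)))) F)
  where
  eq : ∀ j → natrec (encode oracleᶜ) (λ _ r → pair 6 (pair r (encode succᶜ))) j ≡ encode (shiftᶜ j)
  eq zero    = refl
  eq (suc j) = cong (λ r → pair 6 (pair r (encode succᶜ))) (eq j)

Φ-encode : ∀ c {g h} → (∀ n → ⟦ c ⟧ g n (h n)) → Φ (encode c) g h
Φ-encode c {g} {h} computes n = subst (λ d → ⟦ d ⟧ g n (h n)) (sym (decode-encode c)) (computes n)

-- The learner

module _ (T : ComputableTree) where

  open ComputableTree T

  skip : List ℕ → ℕ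
  skip []      = 0
  skip (x ∷ σ) = if member (x ∷ σ) then 0 else suc (skip σ)

  skip-node : ∀ σ → Node T σ → skip σ ≡ 0
  skip-node []      nd = refl
  skip-node (x ∷ σ) nd rewrite nd = refl

  skip-∷ : ∀ x σ → ¬ Node T (x ∷ σ) → skip (x ∷ σ) ≡ suc (skip σ)
  skip-∷ x σ ¬nd with member (x ∷ σ)
  ... | true  = contradiction refl ¬nd
  ... | false = refl

  skipC : Comp (λ n → skip (list n))
  skipC = Comp-ext (λ n → eq (list n))
    (recListC (λ _ x q r → ifz (bit (does (node? (suc (pair x q))))) (suc r) 0) zeroC
      (ifzC (char (nodeP T) ∘C sucC ∘C pairC (leftC ∘C rightC) (leftC ∘C rightC ∘C rightC))
            (sucC ∘C rightC ∘C rightC ∘C rightC) zeroC) idC)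
    where
    node? : ∀ n → Dec (Node T (list n))
    node? = dec (nodeP T)

    F : List ℕ → ℕ
    F = recList 0 (λ x τ r → ifz (bit (does (node? (suc (pair x ⌜ τ ⌝))))) (suc r) 0)

    eq : ∀ σ → F σ ≡ skip σ
    eq []      = refl
    eq (x ∷ σ) rewrite list-⌜⌝ (x ∷ σ) | eq σ with member (x ∷ σ)
    ... | true  = refl
    ... | false = refl

  learner : List ℕ → ℕ
  learner σ = encode (shiftᶜ (skip σ))

  learner-computable : ComputableOnStrings learner
  learner-computable = code C , λ σ →
    subst (λ τ → ⟦ code C ⟧ _ ⌜ σ ⌝ (learner τ)) (list-⌜⌝ σ) (sound C ⌜ σ ⌝)
    where
    C : Comp (λ n → learner (list n))
    C = encode-shiftC skipC

  -- Each `i < j` is refuted by some initial segment, and the refutation persists because `T` is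
  -- closed under prefixes; the guess `j` is never refuted. The induction removes the first entry of
  -- `g`.
  skip-limit : ∀ j {g} → shiftBy j g ∈ Paths T →
    (∀ i → i < j → ∃ λ n → ¬ Node T (shiftBy i g ↾ n)) → HasLimit (λ n → skip (g ↾ n)) j
  skip-limit zero path below = 0 , λ n _ → skip-node _ (path n)
  skip-limit (suc j) {g} path below =
    let n₀ , ¬node = below 0 (s≤s z≤n)
        N , limit = skip-limit j {g ∘ suc} path (λ i i<j → below (suc i) (s≤s i<j))
    in suc (n₀ ⊔ N) , λ
      { (suc n) (s≤s le) → trans
          (skip-∷ (g 0) ((g ∘ suc) ↾ n) λ nd →
            let τ , eq = ↾-≤ g {n₀} {suc n} (m≤n⇒m≤1+n (≤-trans (m≤m⊔n n₀ N) le)) in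
            ¬node (node-++ T _ τ (subst (Node T) eq nd)))
          (cong suc (limit n (≤-trans (m≤n⊔m n₀ N) le))) }

-- Reduction of P to sets whose elements have tails in P

module _ (lem : ExcludedMiddle 0ℓ) (T : ComputableTree) where

  LeastTail : Baire → ℕ → Set
  LeastTail g j = shiftBy j g ∈ Paths T × (∀ i → i < j → ¬ shiftBy i g ∈ Paths T)

  leastTail-resp : ∀ {f g j} → f ≗ g → LeastTail f j → LeastTail g j
  leastTail-resp {j = j} eq (path , below) =
    paths-resp T (λ i → eq (j + i)) path ,
    λ i i<j path′ → below i i<j (paths-resp T (λ k → sym (eq (i + k))) path′)

  leastTail-unique : ∀ {g i j} → LeastTail g i → LeastTail g j → i ≡ j
  leastTail-unique {i = i} {j} (p , below) (p′ , below′) =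
    ≤-antisym (≮⇒≥ (λ j<i → below j j<i p′)) (≮⇒≥ (λ i<j → below′ i i<j p))

  -- Choosing the least tail makes the relation single-valued and agrees with the limit of the
  -- learner.
  tailΓ : PartialFunction
  tailΓ = record
    { graph      = λ g h → ∃ λ j → LeastTail g j × h ≗ shiftBy j g
    ; respects   = (λ eq (j , lt , eq′) → j , lt , λ i → trans (sym (eq i)) (eq′ i)) ,
                   (λ eq (j , lt , eq′) → j , leastTail-resp eq lt , λ i → trans (eq′ i) (eq (j + i)))
    ; functional = λ {g} (j , lt , eq) (j′ , lt′ , eq′) i → trans (eq i)
        (trans (cong (λ k → g (k + i)) (leastTail-unique {g} lt lt′)) (sym (eq′ i)))
    }

  tailΓ-computable : ⟨1,ω⟩-computable tailΓ
  tailΓ-computable = learner T , learner-computable T , λ {g} {h} (j , (path , below) , eq) →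
    let N , limit = skip-limit T j path (λ i i<j → ¬∀⇒∃¬ lem (below i i<j)) in
    encode (shiftᶜ j) , (N , λ n n≥N → cong (encode ∘ shiftᶜ) (limit n n≥N)) ,
    Φ-encode (shiftᶜ j) (λ n → subst (⟦ shiftᶜ j ⟧ g n) (sym (eq n)) (shiftᶜ-sound j g n))

  tail-reduction : ∀ {P X} → P ≐ Paths T → (∀ {g} → g ∈ X → ∃ λ j → shiftBy j g ∈ Paths T) →
                   P ≤[ ⟨1,ω⟩-computable ] X
  tail-reduction (to , from) tail = tailΓ , tailΓ-computable ,
    (λ {g} g∈X → let j , path = tail g∈X
                     k , leastTail = least (λ i → lem {shiftBy i g ∈ Paths T}) j path
                 in shiftBy k g , k , leastTail , λ _ → refl) ,
    λ g∈X (j , (path , _) , eq) → from (paths-resp T (λ i → sym (eq i)) path)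

  ▽-tail : ∀ {P} → P ≐ Paths T → ∀ {g} → g ∈ ▽ T P → ∃ λ j → shiftBy j g ∈ Paths T
  ▽-tail {P} (to , from) (n , g∈) = go n g∈
    where
    shift-⌢ : ∀ ρ f i → (ρ ⌢ f) (length ρ + i) ≡ f i
    shift-⌢ []      f i = refl
    shift-⌢ (x ∷ ρ) f i = shift-⌢ ρ f i

    go : ∀ n {g} → g ∈ iterate⌢ T P n → ∃ λ j → shiftBy j g ∈ Paths T
    go zero    g∈P        = 0 , to g∈P
    go (suc n) (inj₁ g∈P) = 0 , to g∈P
    go (suc n) {g} (inj₂ (ρ , _ , f , f∈ , eq)) = let j , path = go n f∈ in
      length ρ + j , paths-resp T (λ i → sym (trans (cong g (+-assoc (length ρ) j i))
        (trans (eq _) (shift-⌢ ρ f (j + i))))) path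

-- Reductions by inclusion

idΓ : PartialFunction
idΓ = record
  { graph      = λ g h → g ≗ h
  ; respects   = (λ eq eq′ i → trans (eq′ i) (eq i)) , (λ eq eq′ i → trans (sym (eq i)) (eq′ i))
  ; functional = λ eq eq′ i → trans (sym (eq i)) (eq′ i)
  }

Φ-oracle : ∀ {g h} → g ≗ h → Φ (encode oracleᶜ) g h
Φ-oracle eq = Φ-encode oracleᶜ (λ n → sym (eq n))

inclusion-reduction : ∀ {𝒞 : Pred PartialFunction 0ℓ} {A B : Pred Baire 0ℓ} → 𝒞 idΓ →
  (∀ {g h} → g ≗ h → g ∈ A → h ∈ A) → B ⊆ A → A ≤[ 𝒞 ] B
inclusion-reduction c resp B⊆A =
  idΓ , c , (λ {g} _ → g , λ _ → refl) , λ g∈B eq → resp eq (B⊆A g∈B)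

idΓ-<ω : ⟨<ω,1⟩-computable idΓ
idΓ-<ω = suc (encode oracleᶜ) , λ eq → encode oracleᶜ , ≤-refl , Φ-oracle eq

idΓ-ω : ⟨1,ω⟩-computable idΓ
idΓ-ω = (λ _ → encode oracleᶜ) , (code const , λ σ → sound const ⌜ σ ⌝) ,
  λ eq → encode oracleᶜ , (0 , λ _ _ → refl) , Φ-oracle eq
  where
  const : Comp (λ _ → encode oracleᶜ)
  const = constC (encode oracleᶜ)

special-resp : ∀ {P X : Pred Baire 0ℓ} → P ≐ X → Special P → Special X
special-resp (to , from) ((f , f∈) , ¬comp) = (f , to f∈) , λ x∈ → ¬comp (from x∈)

corollary52 : ExcludedMiddle 0ℓ →
    ((P : Pred Baire 0ℓ) (T : ComputableTree) → P ≐ Paths T → Special P →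
    (▽ T P <[ ⟨<ω,1⟩-computable ] P) × (P ≡[ ⟨1,ω⟩-computable ] ▽ T P))
    ×
    ((P : Pred Baire 0ℓ) → IsΠ⁰₁ P → Special P →
    ∃ λ (Q : Pred Baire 0ℓ) → IsΠ⁰₁ Q ×
    (Q <[ ⟨<ω,1⟩-computable ] P) × (P ≡[ ⟨1,ω⟩-computable ] Q))
corollary52 lem = part₁ , part₂
  where
  part₁ : (P : Pred Baire 0ℓ) (T : ComputableTree) → P ≐ Paths T → Special P →
    (▽ T P <[ ⟨<ω,1⟩-computable ] P) × (P ≡[ ⟨1,ω⟩-computable ] ▽ T P)
  part₁ P T P≐ special =
    (inclusion-reduction idΓ-<ω ▽-resp (0 ,_) ,
     -- The continuations of chains lie in Q and therefore in ▽P.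
     irreducible lem T special′ P≐ (λ r s leaf path →
       Q⊆▽ lem T special′ P≐ (chain⌢paths⊆Q T r s leaf path))) ,
    tail-reduction lem T P≐ (▽-tail lem T P≐) ,
    inclusion-reduction idΓ-ω ▽-resp (0 ,_)
    where
    special′ : Special (Paths T)
    special′ = special-resp P≐ special

    ▽-resp : ∀ {g h} → g ≗ h → g ∈ ▽ T P → h ∈ ▽ T P
    ▽-resp eq (n , g∈) = n , iterate-resp T P≐ n eq g∈

  part₂ : (P : Pred Baire 0ℓ) → IsΠ⁰₁ P → Special P →
    ∃ λ (Q : Pred Baire 0ℓ) → IsΠ⁰₁ Q ×
    (Q <[ ⟨<ω,1⟩-computable ] P) × (P ≡[ ⟨1,ω⟩-computable ] Q)
  part₂ P (T , P≐@(to , _)) special =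
    Paths (treeQ T) , (treeQ T , id , id) ,
    (inclusion-reduction idΓ-<ω (paths-resp (treeQ T)) (λ p → paths⊆Q T (to p)) ,
     irreducible lem T special′ P≐ (chain⌢paths⊆Q T)) ,
    -- Elements of Q lie in ▽P, so they have a tail in P.
    tail-reduction lem T P≐ (λ g∈Q → ▽-tail lem T P≐ (Q⊆▽ lem T special′ P≐ g∈Q)) ,
    inclusion-reduction idΓ-ω (paths-resp (treeQ T)) (λ p → paths⊆Q T (to p))
    where
    special′ : Special (Paths T)
    special′ = special-resp P≐ special
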